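{- Let $m\geqslant 3$ and $n\geqslant 3$ be distinct odd integers. Then the number of distinct $C_4$-face-magic projective labelings on $\mathcal{P}_{m,n}$, counted up to symmetries of the projective plane, is at least $\bigl(\tau(m,n)+\tau(n,m)\bigr)\,2^{m/2+n/2-3}\Bigl(\bigl(\tfrac{m-1}{2}\bigr)!\,\bigl(\tfrac{n-1}{2}\bigr)!+2\,\beta(m)\,\beta(n)\Bigr)$.
   Context: $\mathcal{P}_{m,n}$ has vertices $(i,j)$, $1\leqslant i\leqslant m$, $1\leqslant j\leqslant n$, and edges $(i,j)$–$(i,j+1)$ ($j\leqslant n-1$), $(i,n)$–$(m+1-i,1)$, $(i,j)$–$(i+1,j)$ ($i\leqslant m-1$), $(m,j)$–$(1,n+1-j)$, embedded naturally in the projective plane. Its 4-cycle faces are $\{(i,j),(i+1,j),(i,j+1),(i+1,j+1)\}$ ($1\leqslant i\leqslant m-1$, $1\leqslant j\leqslant n-1$), $\{(i,n),(i+1,n),(m+1-i,1),(m-i,1)\}$ ($1\leqslant i\leqslant m-1$), $\{(m,j),(m,j+1),(1,n+1-j),(1,n-j)\}$ ($1\leqslant j\leqslant n-1$); the other two faces are digons. A $C_4$-face-magic projective labeling is a bijection from the vertices onto $\{1,\ldots,mn\}$ such that every 4-cycle face has the same label sum. For $m\neq n$ the symmetries of $\mathcal{P}_{m,n}$ are the four automorphisms $(i,j)\mapsto(i,j)$, $(m+1-i,n+1-j)$, $(i,n+1-j)$, $(m+1-i,j)$; labelings are counted up to precomposition with these. For positive integer $k$, an $(m,n)$-projective factorization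 sequence is a tuple $(m_1,n_1,\ldots,m_k,n_k)$ of integers $>1$ with $m=m_1\cdots m_k$, $n=n_1\cdots n_k$, or a tuple $(m_1,n_1,\ldots,m_k,n_k,m_{k+1})$ of integers $>1$ with $m=m_1\cdots m_{k+1}$, $n=n_1\cdots n_k$; $\tau(m,n)$ is the number of distinct such sequences, and $\tau(n,m)$ is defined with $m$ and $n$ exchanged. For odd $m\geqslant3$, $\beta(m)=\bigl((\tfrac{m-1}{4})!\bigr)^2$ if $m\equiv1\pmod4$ and $\beta(m)=(\tfrac{m-3}{4})!\,(\tfrac{m+1}{4})!$ if $m\equiv3\pmod4$. -}

module Defs where

open import Data.Nat using (ℕ; zero; suc; _+_; _*_; _∸_; _<_; _<?_)
open import Data.Nat.DivMod using (_/_; _%_)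
open import Data.Nat using (_!)
open import Data.Fin using (Fin; toℕ; fromℕ<; opposite)
open import Data.Bool using (Bool; true; false)
open import Data.List using (List; []; _∷_; _++_; map; length)
open import Data.Nat.ListAction using (product)
open import Data.List.Relation.Unary.All using (All)
open import Data.List.Relation.Unary.AllPairs using (AllPairs)
open import Data.List.Relation.Unary.Unique.Propositional using (Unique)
open import Data.List.Membership.Propositional using (_∈_)
open import Data.Product using (Σ; ∃; _×_; _,_; proj₁; proj₂; uncurry)
open import Data.Sum using (_⊎_)
open import Relation.Nullary using (¬_; yes; no)
open import Relation.Binary.PropositionalEquality using (_≡_; _≢_)
open import Function.Bundles using (_⇔_)
open import Function.Definitions using (Bijective)

-- Labelings of P_{m,n}.  Vertices (i,j), 1 ≤ i ≤ m, 1 ≤ j ≤ n are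
-- represented 0-based by (Fin m × Fin n); a labeling L sends vertex
-- (i,j) to the label  toℕ (L i j) + 1  ∈ {1,…,mn}.

Labeling : ℕ → ℕ → Set
Labeling m n = Fin m → Fin n → Fin (m * n)

IsBijectiveLabeling : {m n : ℕ} → Labeling m n → Set
IsBijectiveLabeling L = Bijective _≡_ _≡_ (uncurry L)

-- label of the 0-based vertex (i,j), as a natural number in 1..mn
-- (out of range indices give 0; they are never used below)
lab : {m n : ℕ} → Labeling m n → ℕ → ℕ → ℕ
lab {m} {n} L i j with i <? m | j <? n
... | yes p | yes q = suc (toℕ (L (fromℕ< p) (fromℕ< q)))
... | _     | _     = 0

FaceSums : {m n : ℕ} → Labeling m n → ℕ → Set
FaceSums {m} {n} L S =
  (∀ i j → suc i < m → suc j < n →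
     lab L i j + lab L (suc i) j + lab L i (suc j) + lab L (suc i) (suc j) ≡ S)
  × (∀ i → suc i < m →
     lab L i (n ∸ 1) + lab L (suc i) (n ∸ 1) + lab L (m ∸ 1 ∸ i) 0 + lab L (m ∸ 2 ∸ i) 0 ≡ S)
  × (∀ j → suc j < n →
     lab L (m ∸ 1) j + lab L (m ∸ 1) (suc j) + lab L 0 (n ∸ 1 ∸ j) + lab L 0 (n ∸ 2 ∸ j) ≡ S)

IsFaceMagic : {m n : ℕ} → Labeling m n → Set
IsFaceMagic L = IsBijectiveLabeling L × ∃ λ S → FaceSums L S

-- Symmetries: (i,j) ↦ (i,j), (m+1-i,n+1-j), (i,n+1-j), (m+1-i,j);
-- in 0-based form each coordinate is either kept or replaced by its
-- opposite.

flipIf : {k : ℕ} → Bool → Fin k → Fin k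
flipIf true  i = opposite i
flipIf false i = i

SymEquiv : {m n : ℕ} → Labeling m n → Labeling m n → Set
SymEquiv L L' = Σ Bool λ a → Σ Bool λ b →
  ∀ i j → L' i j ≡ L (flipIf a i) (flipIf b j)

flat : List (ℕ × ℕ) → List ℕ
flat []             = []
flat ((a , b) ∷ ps) = a ∷ b ∷ flat ps

IsProjFactSeq : ℕ → ℕ → List ℕ → Set
IsProjFactSeq m n s =
  (Σ (List (ℕ × ℕ)) λ ps →
     ps ≢ [] × All (λ p → 1 < proj₁ p × 1 < proj₂ p) ps
     × product (map proj₁ ps) ≡ m × product (map proj₂ ps) ≡ n
     × s ≡ flat ps)
  ⊎
  (Σ (List (ℕ × ℕ)) λ ps → Σ ℕ λ e →
     ps ≢ [] × All (λ p → 1 < proj₁ p × 1 < proj₂ p) ps × 1 < e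
     × product (map proj₁ ps) * e ≡ m × product (map proj₂ ps) ≡ n
     × s ≡ flat ps ++ e ∷ [])

IsCount : (List ℕ → Set) → ℕ → Set
IsCount P t = Σ (List (List ℕ)) λ xs →
  Unique xs × (∀ s → (s ∈ xs) ⇔ P s) × length xs ≡ t

-- β(m) for odd m ≥ 3

β : ℕ → ℕ
β m with m % 4
... | 1 = ((m ∸ 1) / 4) ! * ((m ∸ 1) / 4) !
... | _ = ((m ∸ 3) / 4) ! * ((m + 1) / 4) !

{-# OPTIONS --safe #-}

-- With α and β centrally symmetric sequences of lengths m and n whose sums α i + β j run through
-- 0, …, mn - 1 exactly once, the labeling (i , j) ↦ α i* + β j* is face-magic, where i* is i or its
-- reflection according to the parity of j, and j* is j or its reflection according to the parity of i:
-- in every face the α-terms and the β-terms split into reflected pairs.  The pairs of value sets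
-- {α i}, {β j} come from mixed radix expansions, one for each factorization sequence of (m , n) or
-- (n , m), and each set may be arranged by any permutation commuting with the reflection.
--
-- All radices are odd, so the increasing enumerations preserve parity.  If the permutations do so too,
-- then x = α i* + β j* has the parity of i + j, so that every face carries two even and two odd
-- values; halving x modulo mn therefore keeps the face sums constant, and so does taking complements
-- afterwards.  These three kinds of labelings are told apart by the sum of the labels of antipodal
-- corners.  The arrangements are normalised by requiring that the first value lie in the lower half,
-- which accounts for the symmetries of the projective plane.
module Submission where

open import Defs
open import Data.Bool using (Bool; true; false; not; _xor_)
open import Data.Bool.Properties using (not-involutive; not-distribˡ-xor; not-distribʳ-xor; xor-same; xor-assoc; xor-identityʳ)
open import Data.Empty using (⊥)
open import Data.Fin using (Fin; toℕ; fromℕ<; remQuot)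
open import Data.Fin.Properties using (toℕ<n; toℕ-injective; toℕ-fromℕ<; opposite-prop; injective⇒≤; any?; punchOut-injective; *↔×; +↔⊎; 2↔Bool)
open import Data.List using (List; []; _∷_; _++_; map; length; lookup; tabulate)
open import Data.List.Membership.Propositional using (_∈_)
open import Data.List.Membership.Propositional.Properties using (∈-lookup)
open import Data.List.Properties using (length-tabulate; ∷-injectiveʳ)
open import Data.List.Relation.Unary.All using (All; []; _∷_)
open import Data.List.Relation.Unary.AllPairs using (AllPairs; []; _∷_)
open import Data.List.Relation.Unary.Unique.Propositional using (Unique)
open import Data.Nat using (ℕ; zero; suc; _+_; _*_; _∸_; _^_; _≤_; _<_; _≤?_; _<?_; z≤n; s≤s; z<s; s≤s⁻¹; ⌊_/2⌋; ⌈_/2⌉)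
open import Data.Nat using (_!)
open import Data.Nat.DivMod
open import Data.Nat.Divisibility using (divides-refl)
open import Data.Nat.ListAction using (product)
open import Data.Nat.Properties
open import Data.Nat.Tactic.RingSolver using (solve-∀)
open import Data.Product using (Σ; ∃; _×_; _,_; proj₁; proj₂; uncurry)
open import Data.Product.Function.NonDependent.Propositional using (_×-↔_)
open import Data.Sum using (_⊎_; inj₁; inj₂; [_,_])
open import Data.Sum.Function.Propositional using (_⊎-↔_)
open import Function using (id; _∘_)
open import Function.Bundles using (Inverse; Injection; Equivalence; _↔_)
open import Function.Construct.Composition using (_↔-∘_)
open import Function.Construct.Identity using (↔-id)
open import Function.Definitions using (Injective; Surjective)
open import Function.Properties.Inverse using (Inverse⇒Injection)
open import Relation.Binary.Definitions using (tri<; tri≈; tri>)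
open import Relation.Binary.PropositionalEquality using (_≡_; _≢_; refl; sym; trans; cong; cong₂; subst; subst₂; module ≡-Reasoning)
open import Relation.Nullary using (¬_; yes; no; contradiction)
import Data.Fin as Fin
import Data.List.Relation.Unary.All as All
import Data.List.Relation.Unary.All.Properties as All
import Data.List.Relation.Unary.AllPairs.Properties as AllPairs
import Data.Sum as Sum

-- Parity and halving

odd : ℕ → Bool
odd zero    = false
odd (suc n) = not (odd n)

odd-+ : ∀ a b → odd (a + b) ≡ odd a xor odd b
odd-+ zero    b = refl
odd-+ (suc a) b = trans (cong not (odd-+ a b)) (not-distribˡ-xor (odd a) (odd b))

odd-*ˡ : ∀ a b → odd a ≡ true → odd (a * b) ≡ odd b
even-*ˡ : ∀ a b → odd a ≡ false → odd (a * b) ≡ false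
odd-*ˡ (suc a) b oa = begin
  odd (b + a * b)         ≡⟨ odd-+ b (a * b) ⟩
  odd b xor odd (a * b)   ≡⟨ cong (odd b xor_) (even-*ˡ a b even) ⟩
  odd b xor false         ≡⟨ xor-identityʳ (odd b) ⟩
  odd b                   ∎
  where
  open ≡-Reasoning
  even : odd a ≡ false
  even = trans (sym (not-involutive (odd a))) (cong not oa)
even-*ˡ zero    b _  = refl
even-*ˡ (suc a) b ea = begin
  odd (b + a * b)         ≡⟨ odd-+ b (a * b) ⟩
  odd b xor odd (a * b)   ≡⟨ cong (odd b xor_) (odd-*ˡ a b (trans (sym (not-involutive (odd a))) (cong not ea))) ⟩
  odd b xor odd b         ≡⟨ xor-same (odd b) ⟩
  false                   ∎
  where open ≡-Reasoning

odd-factorˡ : ∀ a b → odd (a * b) ≡ true → odd a ≡ true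
odd-factorˡ a b oab with odd a in eq
... | true  = refl
... | false with () ← trans (sym (even-*ˡ a b eq)) oab

odd-factorʳ : ∀ a b → odd (a * b) ≡ true → odd b ≡ true
odd-factorʳ a b oab = odd-factorˡ b a (trans (cong odd (*-comm b a)) oab)

double : ℕ → ℕ
double zero    = zero
double (suc n) = suc (suc (double n))

double≡n+n : ∀ n → double n ≡ n + n
double≡n+n zero    = refl
double≡n+n (suc n) = cong suc (trans (cong suc (double≡n+n n)) (sym (+-suc n n)))

double≡n*2 : ∀ n → double n ≡ n * 2
double≡n*2 zero    = refl
double≡n*2 (suc n) = cong (suc ∘ suc) (double≡n*2 n)

odd-double : ∀ n → odd (double n) ≡ false
odd-double zero    = refl
odd-double (suc n) = trans (not-involutive _) (odd-double n)

double-injective : ∀ {a b} → double a ≡ double b → a ≡ b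
double-injective {zero}  {zero}  _ = refl
double-injective {suc a} {suc b} e = cong suc (double-injective (suc-injective (suc-injective e)))

double-mono-≤ : ∀ {a b} → a ≤ b → double a ≤ double b
double-mono-≤ z≤n       = z≤n
double-mono-≤ (s≤s a≤b) = s≤s (s≤s (double-mono-≤ a≤b))

double-cancel-≤ : ∀ {a b} → double a ≤ double b → a ≤ b
double-cancel-≤ {zero}          _               = z≤n
double-cancel-≤ {suc a} {suc b} (s≤s (s≤s le)) = s≤s (double-cancel-≤ le)

odd-∸ : ∀ {w i} → odd w ≡ false → i ≤ w → odd (w ∸ i) ≡ odd i
odd-∸ {w} {i} ew i≤w = begin
  odd (w ∸ i)                      ≡⟨ sym (xor-identityʳ _) ⟩
  odd (w ∸ i) xor false            ≡⟨ cong (odd (w ∸ i) xor_) (sym (xor-same (odd i))) ⟩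
  odd (w ∸ i) xor (odd i xor odd i) ≡⟨ sym (xor-assoc (odd (w ∸ i)) (odd i) (odd i)) ⟩
  (odd (w ∸ i) xor odd i) xor odd i ≡⟨ cong (_xor odd i) (sym (odd-+ (w ∸ i) i)) ⟩
  odd (w ∸ i + i) xor odd i        ≡⟨ cong (λ x → odd x xor odd i) (m∸n+n≡m i≤w) ⟩
  odd w xor odd i                  ≡⟨ cong (_xor odd i) ew ⟩
  odd i                            ∎
  where open ≡-Reasoning

halve : ℕ → ℕ ⊎ ℕ
halve zero          = inj₁ zero
halve (suc zero)    = inj₂ zero
halve (suc (suc n)) = Sum.map suc suc (halve n)

halve-double : ∀ q → halve (double q) ≡ inj₁ q
halve-double zero    = refl
halve-double (suc q) = cong (Sum.map suc suc) (halve-double q)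

halve-suc-double : ∀ q → halve (suc (double q)) ≡ inj₂ q
halve-suc-double zero    = refl
halve-suc-double (suc q) = cong (Sum.map suc suc) (halve-suc-double q)

-- Definitions compute with `halve`; proofs match on this view instead, which replaces the argument
-- itself by `double q` or `suc (double q)`, so that the computation rules of `halve` apply.
data Halved : ℕ → Set where
  2× : ∀ q → Halved (double q)
  2×+1 : ∀ q → Halved (suc (double q))

halved : ∀ n → Halved n
halved zero    = 2× zero
halved (suc n) with halved n
... | 2× q = 2×+1 q
... | 2×+1 q = 2× (suc q)

divMod-unique : ∀ d {r} q → r ≤ d → (r + q * suc d) % suc d ≡ r × (r + q * suc d) / suc d ≡ q
divMod-unique d {r} q r≤d =
  trans ([m+kn]%n≡m%n r q (suc d)) (m<n⇒m%n≡m (s≤s r≤d)) ,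
  trans (+-distrib-/-∣ʳ r (divides-refl q)) (cong₂ _+_ (m<n⇒m/n≡0 (s≤s r≤d)) (m*n/n≡m q (suc d)))

-- Direct sum decompositions of an interval

-- Removing the first radix exchanges odd and even places, so the notions attached to a list of
-- radices come as mutually recursive pairs in which A and B alternate.
sizeA sizeB : List ℕ → ℕ
sizeA []      = 1
sizeA (d ∷ s) = d * sizeB s
sizeB []      = 1
sizeB (d ∷ s) = sizeA s

-- Mixed radix expansion of 0, …, mn - 1 with radices d₁, d₂, …: tileA s enumerates in increasing
-- order the numbers whose digits in even places (counted from 1) vanish, tileB s those whose digits
-- in odd places vanish.  The values for [] and for a zero radix are junk beyond the argument 0; the
-- identity makes both functions increasing on all of ℕ.
tileA tileB : List ℕ → ℕ → ℕ
tileA []          i = i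
tileA (zero ∷ s)  i = i
tileA (suc d ∷ s) i = i % suc d + suc d * tileB s (i / suc d)
tileB []          j = j
tileB (zero ∷ s)  j = j
tileB (suc d ∷ s) j = suc d * tileA s j

tileA-0 : ∀ s → tileA s 0 ≡ 0
tileB-0 : ∀ s → tileB s 0 ≡ 0
tileA-0 []          = refl
tileA-0 (zero ∷ s)  = refl
tileA-0 (suc d ∷ s) = trans (cong (suc d *_) (tileB-0 s)) (*-zeroʳ (suc d))
tileB-0 []          = refl
tileB-0 (zero ∷ s)  = refl
tileB-0 (suc d ∷ s) = trans (cong (suc d *_) (tileA-0 s)) (*-zeroʳ (suc d))

tileA-step : ∀ d s {r} q → r ≤ d → tileA (suc d ∷ s) (r + q * suc d) ≡ r + suc d * tileB s q
tileA-step d s q r≤d =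
  cong₂ (λ x y → x + suc d * tileB s y) (proj₁ (divMod-unique d q r≤d)) (proj₂ (divMod-unique d q r≤d))

-- Compare the quotients by the first radix: if they agree, the remainders decide; otherwise the gap
-- of at least one full radix outweighs any remainder.
tileA-mono-< : ∀ s {i i′} → i < i′ → tileA s i < tileA s i′
tileB-mono-< : ∀ s {j j′} → j < j′ → tileB s j < tileB s j′
tileA-mono-< []          lt = lt
tileA-mono-< (zero ∷ s)  lt = lt
tileA-mono-< (suc d ∷ s) {i} {i′} lt with m≤n⇒m<n∨m≡n (/-mono-≤ {o = suc d} {p = suc d} (<⇒≤ lt) ≤-refl)
... | inj₂ q≡q′ = +-mono-<-≤ r<r′ (≤-reflexive (cong (λ q → suc d * tileB s q) q≡q′))
  where
  r<r′ : i % suc d < i′ % suc d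
  r<r′ = +-cancelʳ-< (i / suc d * suc d) _ _
    (subst (i % suc d + i / suc d * suc d <_) (cong (λ q → i′ % suc d + q * suc d) (sym q≡q′))
      (subst₂ _<_ (m≡m%n+[m/n]*n i (suc d)) (m≡m%n+[m/n]*n i′ (suc d)) lt))
... | inj₁ q<q′ = begin-strict
  i % suc d + suc d * tileB s (i / suc d) <⟨ +-monoˡ-< _ (m%n<n i (suc d)) ⟩
  suc d + suc d * tileB s (i / suc d)     ≡⟨ sym (*-suc (suc d) _) ⟩
  suc d * suc (tileB s (i / suc d))       ≤⟨ *-monoʳ-≤ (suc d) (tileB-mono-< s q<q′) ⟩
  suc d * tileB s (i′ / suc d)            ≤⟨ m≤n+m _ (i′ % suc d) ⟩
  i′ % suc d + suc d * tileB s (i′ / suc d) ∎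
  where open ≤-Reasoning
tileB-mono-< []          lt = lt
tileB-mono-< (zero ∷ s)  lt = lt
tileB-mono-< (suc d ∷ s) lt = *-monoʳ-< (suc d) (tileA-mono-< s lt)

-- For positive radices these are the values at the last index, where every digit is one less than
-- its radix.
topA topB : List ℕ → ℕ
topA []      = 0
topA (d ∷ s) = (d ∸ 1) + d * topB s
topB []      = 0
topB (d ∷ s) = d * topA s

-- With all digits maximal in both enumerations, the sum is the last number of the interval.
topA+topB : ∀ s → All (0 <_) s → suc (topA s + topB s) ≡ sizeA s * sizeB s
topA+topB []          []         = refl
topA+topB (suc d ∷ s) (_ ∷ pos) = begin
  suc (d + suc d * topB s + suc d * topA s) ≡⟨ lemma d (topA s) (topB s) ⟩
  suc d * suc (topA s + topB s)             ≡⟨ cong (suc d *_) (topA+topB s pos) ⟩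
  suc d * (sizeA s * sizeB s)               ≡⟨ lemma′ (suc d) (sizeA s) (sizeB s) ⟩
  suc d * sizeB s * sizeA s                 ∎
  where
  open ≡-Reasoning
  lemma : ∀ d a b → suc (d + suc d * b + suc d * a) ≡ suc d * suc (a + b)
  lemma = solve-∀
  lemma′ : ∀ d a b → d * (a * b) ≡ d * b * a
  lemma′ = solve-∀

1+i+i′≡n⇒i<n : ∀ {i i′ n} → suc (i + i′) ≡ n → i < n
1+i+i′≡n⇒i<n {i} {i′} refl = s≤s (m≤m+n i i′)

-- Reflecting the index complements each digit. If `i` has remainder `r` and quotient `q` by
-- `suc d`, its reflection has remainder `d ∸ r` and quotient `N ∸ q`, where `suc N` is `sizeB s`.
tileA-reflect : ∀ s → All (0 <_) s → ∀ {i i′} → suc (i + i′) ≡ sizeA s → tileA s i + tileA s i′ ≡ topA s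
tileB-reflect : ∀ s → All (0 <_) s → ∀ {j j′} → suc (j + j′) ≡ sizeB s → tileB s j + tileB s j′ ≡ topB s
tileA-reflect []          []        eq = suc-injective eq
tileA-reflect (suc d ∷ s) (_ ∷ pos) {i} {i′} eq
  with sizeB s in eqN | m<n*o⇒m/o<n {i} {sizeB s} {suc d} (subst (i <_) (*-comm (suc d) (sizeB s)) (1+i+i′≡n⇒i<n eq))
... | zero  | ()
... | suc N | s≤s q≤N = begin
  tileA (suc d ∷ s) i + tileA (suc d ∷ s) i′
    ≡⟨ cong (λ x → tileA (suc d ∷ s) i + tileA (suc d ∷ s) x) i′≡ ⟩
  r + suc d * tileB s q + tileA (suc d ∷ s) ((d ∸ r) + (N ∸ q) * suc d)
    ≡⟨ cong (r + suc d * tileB s q +_) (tileA-step d s (N ∸ q) (m∸n≤m d r)) ⟩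
  r + suc d * tileB s q + ((d ∸ r) + suc d * tileB s (N ∸ q))
    ≡⟨ lemma r (d ∸ r) (suc d) (tileB s q) (tileB s (N ∸ q)) ⟩
  (r + (d ∸ r)) + suc d * (tileB s q + tileB s (N ∸ q))
    ≡⟨ cong₂ (λ x y → x + suc d * y) (m+[n∸m]≡n r≤d)
         (tileB-reflect s pos (trans (cong suc (m+[n∸m]≡n q≤N)) (sym eqN))) ⟩
  d + suc d * topB s ∎
  where
  open ≡-Reasoning
  r = i % suc d
  q = i / suc d
  r≤d : r ≤ d
  r≤d = s≤s⁻¹ (m%n<n i (suc d))
  lemma : ∀ r r′ d x y → r + d * x + (r′ + d * y) ≡ (r + r′) + d * (x + y)
  lemma = solve-∀
  lemma₂ : ∀ r r′ d x y → suc ((r + x * suc d) + (r′ + y * suc d)) ≡ suc (r + r′) + suc d * (x + y)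
  lemma₂ = solve-∀
  i′≡ : i′ ≡ (d ∸ r) + (N ∸ q) * suc d
  i′≡ = +-cancelˡ-≡ i _ _ (suc-injective (begin
    suc (i + i′) ≡⟨ trans eq (cong (suc d *_) eqN) ⟩
    suc d * suc N ≡⟨ *-suc (suc d) N ⟩
    suc d + suc d * N ≡⟨ cong₂ (λ x y → suc x + suc d * y) (sym (m+[n∸m]≡n r≤d)) (sym (m+[n∸m]≡n q≤N)) ⟩
    suc (r + (d ∸ r)) + suc d * (q + (N ∸ q)) ≡⟨ sym (lemma₂ r (d ∸ r) d q (N ∸ q)) ⟩
    suc (r + q * suc d + ((d ∸ r) + (N ∸ q) * suc d)) ≡⟨ cong (λ x → suc (x + ((d ∸ r) + (N ∸ q) * suc d))) (sym (m≡m%n+[m/n]*n i (suc d))) ⟩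
    suc (i + ((d ∸ r) + (N ∸ q) * suc d)) ∎))
tileB-reflect []          []        eq = suc-injective eq
tileB-reflect (suc d ∷ s) (_ ∷ pos) {j} {j′} eq =
  trans (sym (*-distribˡ-+ (suc d) (tileA s j) (tileA s j′))) (cong (suc d *_) (tileA-reflect s pos eq))

-- Modulo the first radix the sum reveals the remainder of `i`. Its quotient is a sum of the same
-- shape for `s`, in which `j` becomes the A-index and the quotient of `i` the B-index.
tile-sum-injective : ∀ s → All (0 <_) s → ∀ {i i′ j j′} → i < sizeA s → i′ < sizeA s → j < sizeB s → j′ < sizeB s →
  tileA s i + tileB s j ≡ tileA s i′ + tileB s j′ → i ≡ i′ × j ≡ j′
tile-sum-injective [] [] (s≤s z≤n) (s≤s z≤n) (s≤s z≤n) (s≤s z≤n) _ = refl , refl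
tile-sum-injective (suc d ∷ s) (_ ∷ pos) {i} {i′} {j} {j′} i< i′< j< j′< eq = i≡i′ , proj₁ rec
  where
  open ≡-Reasoning
  D = suc d
  lemma : ∀ r d x y → r + d * x + d * y ≡ r + (y + x) * d
  lemma = solve-∀
  eq′ : i % D + (tileA s j + tileB s (i / D)) * D ≡ i′ % D + (tileA s j′ + tileB s (i′ / D)) * D
  eq′ = trans (sym (lemma (i % D) D _ _)) (trans eq (lemma (i′ % D) D _ _))
  dm = divMod-unique d (tileA s j + tileB s (i / D)) (s≤s⁻¹ (m%n<n i D))
  dm′ = divMod-unique d (tileA s j′ + tileB s (i′ / D)) (s≤s⁻¹ (m%n<n i′ D))
  r≡r′ : i % D ≡ i′ % D
  r≡r′ = trans (sym (proj₁ dm)) (trans (cong (_% D) eq′) (proj₁ dm′))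
  bound : ∀ {x} → x < D * sizeB s → x / D < sizeB s
  bound {x} x< = m<n*o⇒m/o<n {x} {sizeB s} {D} (subst (x <_) (*-comm D (sizeB s)) x<)
  rec : j ≡ j′ × i / D ≡ i′ / D
  rec = tile-sum-injective s pos j< j′< (bound i<) (bound i′<)
          (trans (sym (proj₂ dm)) (trans (cong (_/ D) eq′) (proj₂ dm′)))
  i≡i′ : i ≡ i′
  i≡i′ = begin
    i                   ≡⟨ m≡m%n+[m/n]*n i D ⟩
    i % D + i / D * D   ≡⟨ cong₂ (λ r q → r + q * D) r≡r′ (proj₂ rec) ⟩
    i′ % D + i′ / D * D ≡⟨ sym (m≡m%n+[m/n]*n i′ D) ⟩
    i′                  ∎

All-odd : ∀ s → odd (sizeA s) ≡ true → odd (sizeB s) ≡ true → All (λ d → odd d ≡ true) s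
All-odd []      _  _  = []
All-odd (d ∷ s) oA oB = odd-factorˡ d (sizeB s) oA ∷ All-odd s oB (odd-factorʳ d (sizeB s) oA)

-- Odd weights are 1 modulo 2, so an index and its value are both congruent to the sum of their
-- common digits.
odd-tileA : ∀ s → All (λ d → odd d ≡ true) s → ∀ i → odd (tileA s i) ≡ odd i
odd-tileB : ∀ s → All (λ d → odd d ≡ true) s → ∀ j → odd (tileB s j) ≡ odd j
odd-tileA []          _        i = refl
odd-tileA (suc d ∷ s) (od ∷ os) i = begin
  odd (i % D + D * tileB s (i / D))          ≡⟨ odd-+ (i % D) _ ⟩
  odd (i % D) xor odd (D * tileB s (i / D))  ≡⟨ cong (odd (i % D) xor_) (odd-*ˡ D (tileB s (i / D)) od) ⟩
  odd (i % D) xor odd (tileB s (i / D))      ≡⟨ cong (odd (i % D) xor_) (odd-tileB s os (i / D)) ⟩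
  odd (i % D) xor odd (i / D)                ≡⟨ cong (odd (i % D) xor_) (sym (odd-*ˡ D (i / D) od)) ⟩
  odd (i % D) xor odd (D * (i / D))          ≡⟨ sym (odd-+ (i % D) _) ⟩
  odd (i % D + D * (i / D))                  ≡⟨ cong (λ x → odd (i % D + x)) (*-comm D (i / D)) ⟩
  odd (i % D + i / D * D)                    ≡⟨ cong odd (sym (m≡m%n+[m/n]*n i D)) ⟩
  odd i                                      ∎
  where
  open ≡-Reasoning
  D = suc d
odd-tileB []          _        j = refl
odd-tileB (suc d ∷ s) (od ∷ os) j = trans (odd-*ˡ (suc d) (tileA s j) od) (odd-tileA s os j)

size>0 : ∀ s → All (1 <_) s → 0 < sizeA s × 0 < sizeB s
size>0 []      []       = z<s , z<s
size>0 (d ∷ s) (p ∷ ps) with size>0 s ps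
... | a , b = *-mono-≤ (<⇒≤ p) b , a

sizeA>1 : ∀ d s → 1 < d → All (1 <_) s → 1 < sizeA (d ∷ s)
sizeA>1 d s p ps = *-mono-≤ p (proj₂ (size>0 s ps))

tileB-1 : ∀ d e s → 0 < d → 1 < e → tileB (d ∷ e ∷ s) 1 ≡ d
tileB-1 (suc d) (suc (suc e)) s _ _ =
  trans (cong (λ x → suc d * (1 + suc (suc e) * x)) (tileB-0 s)) (trans (cong (λ x → suc d * suc x) (*-zeroʳ (suc (suc e)))) (*-identityʳ (suc d)))
tileB-1 (suc d) (suc zero) s _ (s≤s ())

-- The first radix is read off as the least positive value of tileB.
tile-injective : ∀ d s e t → 0 < d → 0 < e → All (1 <_) s → All (1 <_) t →
  sizeA (d ∷ s) ≡ sizeA (e ∷ t) → sizeB (d ∷ s) ≡ sizeB (e ∷ t) →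
  (∀ i → i < sizeA (d ∷ s) → tileA (d ∷ s) i ≡ tileA (e ∷ t) i) →
  (∀ j → j < sizeB (d ∷ s) → tileB (d ∷ s) j ≡ tileB (e ∷ t) j) →
  d ∷ s ≡ e ∷ t
tile-injective d [] e [] _ _ _ _ eA _ _ _ =
  cong (_∷ []) (trans (sym (*-identityʳ d)) (trans eA (*-identityʳ e)))
tile-injective d [] e (y ∷ t) _ _ _ (py ∷ pt) _ eB _ _ =
  contradiction eB (<⇒≢ (sizeA>1 y t py pt))
tile-injective d (x ∷ s) e [] _ _ (px ∷ ps) _ _ eB _ _ =
  contradiction (sym eB) (<⇒≢ (sizeA>1 x s px ps))
tile-injective d (x ∷ s) e (y ∷ t) d>0 e>0 (px ∷ ps) (py ∷ pt) eA eB tA tB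
  with trans (sym (tileB-1 d x s d>0 px)) (trans (tB 1 (sizeA>1 x s px ps)) (tileB-1 e y t e>0 py))
tile-injective (suc d) (x ∷ s) _ (y ∷ t) d>0 e>0 (px ∷ ps) (py ∷ pt) eA eB tA tB | refl =
  cong (suc d ∷_) (tile-injective x s y t (<⇒≤ px) (<⇒≤ py) ps pt eB
    (*-cancelˡ-≡ (sizeA s) (sizeA t) (suc d) eA)
    -- Once the common first radix is removed the roles change: `tileB` yields the new `tileA`, and
    -- `tileA` at the multiples of that radix yields the new `tileB`.
    (λ i i< → *-cancelˡ-≡ _ _ (suc d) (tB i i<))
    (λ j j< → *-cancelˡ-≡ _ _ (suc d)
      (trans (sym (tileA-step d (x ∷ s) j z≤n))
        (trans (tA (j * suc d) (subst (j * suc d <_) (*-comm (sizeA s) (suc d)) (*-monoˡ-< (suc d) j<)))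
          (tileA-step d (y ∷ t) j z≤n)))))

-- Centrally symmetric permutations

remQuot-injective : ∀ {m} n {i j : Fin (m * n)} → remQuot {m} n i ≡ remQuot {m} n j → i ≡ j
remQuot-injective {m} n = Injection.injective (Inverse⇒Injection (*↔× {m} {n}))

-- punch x is the increasing bijection from ℕ onto ℕ ∖ {x}.
punch : ℕ → ℕ → ℕ
punch zero    y       = suc y
punch (suc x) zero    = zero
punch (suc x) (suc y) = suc (punch x y)

punch-injective : ∀ x {y z} → punch x y ≡ punch x z → y ≡ z
punch-injective zero                    eq = suc-injective eq
punch-injective (suc x) {zero}  {zero}  eq = refl
punch-injective (suc x) {suc y} {suc z} eq = cong suc (punch-injective x (suc-injective eq))

punch≢ : ∀ x y → punch x y ≢ x
punch≢ (suc x) (suc y) eq = punch≢ x y (suc-injective eq)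

punch-≤ : ∀ x y → punch x y ≤ suc y
punch-≤ zero    y       = ≤-refl
punch-≤ (suc x) zero    = z≤n
punch-≤ (suc x) (suc y) = s≤s (punch-≤ x y)

punch-≥ : ∀ {x y} → x ≤ y → punch x y ≡ suc y
punch-≥ z≤n       = refl
punch-≥ (s≤s x≤y) = cong suc (punch-≥ x≤y)

-- Permutations of 0, ..., k - 1 are extended by the identity to all of ℕ. Injectivity then carries
-- no bounds, and `fixed` at `k` itself keeps the centre of a `central` permutation in place.
record IsPerm (k : ℕ) (p : ℕ → ℕ) : Set where
  field
    bounded   : ∀ {i} → i < k → p i < k
    fixed     : ∀ {i} → k ≤ i → p i ≡ i
    injective : ∀ {i j} → p i ≡ p j → i ≡ j

-- The Lehmer code: the leading digit in the factorial number system is the image of 0, and the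
-- permutation coded by the remaining digits is spread over the other values by `punch`.
perm : ∀ k → Fin (k !) → ℕ → ℕ
perm zero    c i       = i
perm (suc k) c zero    = toℕ (proj₁ (remQuot {suc k} (k !) c))
perm (suc k) c (suc i) = punch (toℕ (proj₁ (remQuot {suc k} (k !) c))) (perm k (proj₂ (remQuot {suc k} (k !) c)) i)

perm-isPerm : ∀ k c → IsPerm k (perm k c)
perm-isPerm zero    c = record { bounded = id ; fixed = λ _ → refl ; injective = id }
perm-isPerm (suc k) c = record { bounded = bounded ; fixed = fixed ; injective = injective }
  where
  x = proj₁ (remQuot {suc k} (k !) c)
  open IsPerm (perm-isPerm k (proj₂ (remQuot {suc k} (k !) c))) renaming (bounded to bd; fixed to fx; injective to inj)
  bounded : ∀ {i} → i < suc k → perm (suc k) c i < suc k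
  bounded {zero}  _         = toℕ<n x
  bounded {suc i} (s≤s i<k) = s≤s (≤-trans (punch-≤ (toℕ x) _) (bd i<k))
  fixed : ∀ {i} → suc k ≤ i → perm (suc k) c i ≡ i
  fixed {suc i} (s≤s k≤i) =
    trans (cong (punch (toℕ x)) (fx k≤i)) (punch-≥ (≤-trans (s≤s⁻¹ (toℕ<n x)) k≤i))
  injective : ∀ {i j} → perm (suc k) c i ≡ perm (suc k) c j → i ≡ j
  injective {zero}  {zero}  _  = refl
  injective {zero}  {suc j} eq = contradiction (sym eq) (punch≢ (toℕ x) _)
  injective {suc i} {zero}  eq = contradiction eq (punch≢ (toℕ x) _)
  injective {suc i} {suc j} eq = cong suc (inj (punch-injective (toℕ x) eq))

perm-faithful : ∀ k c c′ → (∀ i → i < k → perm k c i ≡ perm k c′ i) → c ≡ c′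
perm-faithful zero    Fin.zero Fin.zero _ = refl
perm-faithful (suc k) c c′ eq = remQuot-injective {suc k} (k !) (cong₂ _,_ head (perm-faithful k _ _ tail))
  where
  x = proj₁ (remQuot {suc k} (k !) c)
  head : x ≡ proj₁ (remQuot {suc k} (k !) c′)
  head = toℕ-injective (eq 0 z<s)
  tail : ∀ i → i < k → perm k (proj₂ (remQuot {suc k} (k !) c)) i ≡ perm k (proj₂ (remQuot {suc k} (k !) c′)) i
  tail i i<k = punch-injective (toℕ x)
    (trans (eq (suc i) (s≤s i<k)) (cong (λ y → punch (toℕ y) (perm k (proj₂ (remQuot {suc k} (k !) c′)) i)) (sym head)))

-- Permutations preserving parity

interleave : (ℕ → ℕ) → (ℕ → ℕ) → ℕ → ℕ
interleave p q i = [ double ∘ p , suc ∘ double ∘ q ] (halve i)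

interleave-even : ∀ p q i → interleave p q (double i) ≡ double (p i)
interleave-even p q i = cong [ double ∘ p , suc ∘ double ∘ q ] (halve-double i)

interleave-odd : ∀ p q i → interleave p q (suc (double i)) ≡ suc (double (q i))
interleave-odd p q i = cong [ double ∘ p , suc ∘ double ∘ q ] (halve-suc-double i)

odd-interleave : ∀ p q i → odd (interleave p q i) ≡ odd i
odd-interleave p q i with halved i
... | 2× x   = trans (cong odd (interleave-even p q x)) (trans (odd-double (p x)) (sym (odd-double x)))
... | 2×+1 x = trans (cong odd (interleave-odd p q x)) (cong not (trans (odd-double (q x)) (sym (odd-double x))))

1+2x<k⇒x<⌊k/2⌋ : ∀ {k x} → suc (double x) < k → x < ⌊ k /2⌋
1+2x<k⇒x<⌊k/2⌋ {suc zero}    (s≤s ())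
1+2x<k⇒x<⌊k/2⌋ {suc (suc k)} {zero}  _              = z<s
1+2x<k⇒x<⌊k/2⌋ {suc (suc k)} {suc x} (s≤s (s≤s lt)) = s≤s (1+2x<k⇒x<⌊k/2⌋ lt)

x<⌊k/2⌋⇒1+2x<k : ∀ {k x} → x < ⌊ k /2⌋ → suc (double x) < k
x<⌊k/2⌋⇒1+2x<k {suc (suc k)} {zero}  _        = s≤s z<s
x<⌊k/2⌋⇒1+2x<k {suc (suc k)} {suc x} (s≤s lt) = s≤s (s≤s (x<⌊k/2⌋⇒1+2x<k lt))

interleave-isPerm : ∀ k {p q} → IsPerm ⌈ k /2⌉ p → IsPerm ⌊ k /2⌋ q → IsPerm k (interleave p q)
interleave-isPerm k {p} {q} P Q = record { bounded = bounded ; fixed = fixed ; injective = injective }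
  where
  module P = IsPerm P
  module Q = IsPerm Q
  bounded : ∀ {i} → i < k → interleave p q i < k
  bounded {i} i<k with halved i
  -- `⌈ k /2⌉` is by definition `⌊ suc k /2⌋`, so the criterion for odd numbers below `suc k`
  -- decides which even numbers lie below `k`.
  ... | 2× x   = subst (_< k) (sym (interleave-even p q x))
                   (s≤s⁻¹ (x<⌊k/2⌋⇒1+2x<k {suc k} (P.bounded (1+2x<k⇒x<⌊k/2⌋ (s≤s i<k)))))
  ... | 2×+1 x = subst (_< k) (sym (interleave-odd p q x))
                   (x<⌊k/2⌋⇒1+2x<k (Q.bounded (1+2x<k⇒x<⌊k/2⌋ i<k)))
  fixed : ∀ {i} → k ≤ i → interleave p q i ≡ i
  fixed {i} k≤i with halved i
  ... | 2× x   = trans (interleave-even p q x)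
                   (cong double (P.fixed (≮⇒≥ λ lt → ≤⇒≯ k≤i (s≤s⁻¹ (x<⌊k/2⌋⇒1+2x<k {suc k} lt)))))
  ... | 2×+1 x = trans (interleave-odd p q x)
                   (cong (suc ∘ double) (Q.fixed (≮⇒≥ λ lt → ≤⇒≯ k≤i (x<⌊k/2⌋⇒1+2x<k lt))))
  injective : ∀ {i j} → interleave p q i ≡ interleave p q j → i ≡ j
  injective {i} {j} eq with halved i | halved j | trans (sym (odd-interleave p q i)) (trans (cong odd eq) (odd-interleave p q j))
  ... | 2× x   | 2× y   | _ = cong double (P.injective (double-injective
          (trans (sym (interleave-even p q x)) (trans eq (interleave-even p q y)))))
  ... | 2×+1 x | 2×+1 y | _ = cong (suc ∘ double) (Q.injective (double-injective (suc-injective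
          (trans (sym (interleave-odd p q x)) (trans eq (interleave-odd p q y))))))
  ... | 2× x   | 2×+1 y | e rewrite odd-double x | odd-double y with () ← e
  ... | 2×+1 x | 2× y   | e rewrite odd-double x | odd-double y with () ← e

-- Below `k` there are `⌈ k /2⌉` even and `⌊ k /2⌋` odd numbers, permuted independently. This is the
-- factor that `β` contributes to the bound.
parityCount : ℕ → ℕ
parityCount k = ⌈ k /2⌉ ! * ⌊ k /2⌋ !

parityPerm : ∀ k → Fin (parityCount k) → ℕ → ℕ
parityPerm k c = interleave (perm ⌈ k /2⌉ (proj₁ (remQuot (⌊ k /2⌋ !) c))) (perm ⌊ k /2⌋ (proj₂ (remQuot {⌈ k /2⌉ !} (⌊ k /2⌋ !) c)))

parityPerm-isPerm : ∀ k c → IsPerm k (parityPerm k c)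
parityPerm-isPerm k c = interleave-isPerm k (perm-isPerm _ _) (perm-isPerm _ _)

odd-parityPerm : ∀ k c i → odd (parityPerm k c i) ≡ odd i
odd-parityPerm k c = odd-interleave _ _

parityPerm-faithful : ∀ k c c′ → (∀ i → i < k → parityPerm k c i ≡ parityPerm k c′ i) → c ≡ c′
parityPerm-faithful k c c′ eq = remQuot-injective {⌈ k /2⌉ !} (⌊ k /2⌋ !) (cong₂ _,_
  (perm-faithful ⌈ k /2⌉ _ _ λ i lt → double-injective
    (trans (sym (interleave-even _ _ i)) (trans (eq (double i) (s≤s⁻¹ (x<⌊k/2⌋⇒1+2x<k {suc k} lt))) (interleave-even _ _ i))))
  (perm-faithful ⌊ k /2⌋ _ _ λ i lt → double-injective (suc-injective
    (trans (sym (interleave-odd _ _ i)) (trans (eq (suc (double i)) (x<⌊k/2⌋⇒1+2x<k lt)) (interleave-odd _ _ i))))))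

-- Sign patterns and reflections

bits : ∀ k → Fin (2 ^ k) → ℕ → Bool
bits zero    c i       = false
bits (suc k) c zero    = Inverse.to 2↔Bool (proj₁ (remQuot {2} (2 ^ k) c))
bits (suc k) c (suc i) = bits k (proj₂ (remQuot {2} (2 ^ k) c)) i

bits-faithful : ∀ k c c′ → (∀ i → i < k → bits k c i ≡ bits k c′ i) → c ≡ c′
bits-faithful zero    Fin.zero Fin.zero _ = refl
bits-faithful (suc k) c c′ eq = remQuot-injective {2} (2 ^ k) (cong₂ _,_
  (Injection.injective (Inverse⇒Injection 2↔Bool) (eq 0 z<s))
  (bits-faithful k _ _ λ i i<k → eq (suc i) (s≤s i<k)))

-- Used with `suc k` positions in the lower half. Fixing the first sign puts the first value in the
-- lower half, which is the normalisation; the other `k` signs are free.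
signs : ∀ k → Fin (2 ^ k) → ℕ → Bool
signs k c zero    = false
signs k c (suc i) = bits k c i

reflectIf : ℕ → Bool → ℕ → ℕ
reflectIf w true  i = w ∸ i
reflectIf w false i = i

reflectIf-≤ : ∀ {w} b {i} → i ≤ w → reflectIf w b i ≤ w
reflectIf-≤ {w} true  {i} _   = m∸n≤m w i
reflectIf-≤     false     i≤w = i≤w

reflectIf-not : ∀ {w} b {i} → i ≤ w → w ∸ reflectIf w b i ≡ reflectIf w (not b) i
reflectIf-not true  i≤w = m∸[m∸n]≡n i≤w
reflectIf-not false _   = refl

reflectIf-involutive : ∀ {w} b {i} → i ≤ w → reflectIf w b (reflectIf w b i) ≡ i
reflectIf-involutive true  i≤w = m∸[m∸n]≡n i≤w
reflectIf-involutive false _   = refl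

reflectIf-comm : ∀ w a b i → reflectIf w a (reflectIf w b i) ≡ reflectIf w b (reflectIf w a i)
reflectIf-comm w true  true  i = refl
reflectIf-comm w true  false i = refl
reflectIf-comm w false true  i = refl
reflectIf-comm w false false i = refl

odd-reflectIf : ∀ {w} b {i} → odd w ≡ false → i ≤ w → odd (reflectIf w b i) ≡ odd i
odd-reflectIf true  ew i≤w = odd-∸ ew i≤w
odd-reflectIf false ew i≤w = refl

k≤2k : ∀ k → k ≤ double k
k≤2k k = subst (k ≤_) (sym (double≡n+n k)) (m≤m+n k k)

2k∸k : ∀ k → double k ∸ k ≡ k
2k∸k k = trans (cong (_∸ k) (double≡n+n k)) (m+n∸n≡m k k)

2k∸-≥ : ∀ k {x} → x ≤ k → k ≤ double k ∸ x
2k∸-≥ k {x} x≤k = subst (_≤ double k ∸ x) (2k∸k k) (∸-monoʳ-≤ (double k) x≤k)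

2k∸-≤ : ∀ k {x} → k ≤ x → double k ∸ x ≤ k
2k∸-≤ k {x} k≤x = subst (double k ∸ x ≤_) (2k∸k k) (∸-monoʳ-≤ (double k) k≤x)

2k∸-> : ∀ k {x} → x < k → k < double k ∸ x
2k∸-> k {x} x<k = subst (_< double k ∸ x) (2k∸k k) (∸-monoʳ-< x<k (k≤2k k))

2k∸-< : ∀ k {x} → k < x → x ≤ double k → double k ∸ x < k
2k∸-< k {x} k<x x≤2k = subst (double k ∸ x <_) (2k∸k k) (∸-monoʳ-< k<x x≤2k)

-- One side is at most `k` and the other at least `k`, so both equal `k`, and so does `x′`.
x≡2k∸x′⇒x≡x′ : ∀ k {x x′} → x ≤ k → x′ ≤ k → x ≡ double k ∸ x′ → x ≡ x′
x≡2k∸x′⇒x≡x′ k {x} {x′} x≤k x′≤k refl =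
  trans (≤-antisym x≤k (2k∸-≥ k x′≤k)) (≤-antisym (≮⇒≥ λ lt → <⇒≱ (2k∸-> k lt) x≤k) x′≤k)

reflectIf-cancel : ∀ k b b′ {x x′} → x ≤ k → x′ ≤ k → reflectIf (double k) b x ≡ reflectIf (double k) b′ x′ → x ≡ x′
reflectIf-cancel k true  true  x≤k x′≤k eq = ∸-cancelˡ-≡ (≤-trans x≤k (k≤2k k)) (≤-trans x′≤k (k≤2k k)) eq
reflectIf-cancel k false false x≤k x′≤k eq = eq
reflectIf-cancel k false true  x≤k x′≤k eq = x≡2k∸x′⇒x≡x′ k x≤k x′≤k eq
reflectIf-cancel k true  false x≤k x′≤k eq = sym (x≡2k∸x′⇒x≡x′ k x′≤k x≤k (sym eq))

-- The bounds are strict because `k` is its own reflection and does not determine a sign.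
reflectIf-cancel-sign : ∀ k b b′ {x x′} → x < k → x′ < k → reflectIf (double k) b x ≡ reflectIf (double k) b′ x′ → b ≡ b′
reflectIf-cancel-sign k true  true  _ _ _ = refl
reflectIf-cancel-sign k false false _ _ _ = refl
reflectIf-cancel-sign k false true  x<k x′<k eq = contradiction (subst (_< k) eq x<k) (<⇒≯ (2k∸-> k x′<k))
reflectIf-cancel-sign k true  false x<k x′<k eq = contradiction (subst (_< k) (sym eq) x′<k) (<⇒≯ (2k∸-> k x<k))

-- The permutation of {0, …, 2k} commuting with i ↦ 2k - i that sends i ≤ k to
-- p i or to 2k - p i according to the sign s i.
central : ℕ → (ℕ → Bool) → (ℕ → ℕ) → ℕ → ℕ
central k s p i with i ≤? k
... | yes _ = reflectIf (double k) (s i) (p i)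
... | no  _ = double k ∸ reflectIf (double k) (s (double k ∸ i)) (p (double k ∸ i))

module _ (k : ℕ) (s : ℕ → Bool) (p : ℕ → ℕ) where
  central-≤ : ∀ {i} → i ≤ k → central k s p i ≡ reflectIf (double k) (s i) (p i)
  central-≤ {i} i≤k with i ≤? k
  ... | yes _   = refl
  ... | no  i≰k = contradiction i≤k i≰k

  central-> : ∀ {i} → k < i → central k s p i ≡ double k ∸ central k s p (double k ∸ i)
  central-> {i} k<i with i ≤? k
  ... | yes i≤k = contradiction i≤k (<⇒≱ k<i)
  ... | no  _   = cong (double k ∸_) (sym (central-≤ (2k∸-≤ k (<⇒≤ k<i))))

record IsCentral (k : ℕ) (π : ℕ → ℕ) : Set where
  field
    bounded    : ∀ {i} → i ≤ double k → π i ≤ double k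
    symmetric  : ∀ {i} → i ≤ double k → π (double k ∸ i) ≡ double k ∸ π i
    injective  : ∀ {i j} → i ≤ double k → j ≤ double k → π i ≡ π j → i ≡ j
    normalised : π 0 < k

module _ {k : ℕ} {s : ℕ → Bool} {p : ℕ → ℕ} (P : IsPerm k p) where
  private
    module P = IsPerm P
    π = central k s p

    p≤k : ∀ {i} → i ≤ k → p i ≤ k
    p≤k {i} i≤k with m≤n⇒m<n∨m≡n i≤k
    ... | inj₁ i<k = <⇒≤ (P.bounded i<k)
    ... | inj₂ refl = ≤-reflexive (P.fixed ≤-refl)

    low-bounded : ∀ {i} → i ≤ k → π i ≤ double k
    low-bounded {i} i≤k = subst (_≤ double k) (sym (central-≤ k s p i≤k)) (reflectIf-≤ (s i) (≤-trans (p≤k i≤k) (k≤2k k)))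

    bounded : ∀ {i} → i ≤ double k → π i ≤ double k
    bounded {i} i≤ with ≤-<-connex i k
    ... | inj₁ i≤k = low-bounded i≤k
    ... | inj₂ k<i = subst (_≤ double k) (sym (central-> k s p k<i)) (m∸n≤m (double k) (π (double k ∸ i)))

    centre : π k ≡ k
    centre = trans (central-≤ k s p ≤-refl) (trans (cong (reflectIf (double k) (s k)) (P.fixed ≤-refl)) (fix (s k)))
      where
      fix : ∀ b → reflectIf (double k) b k ≡ k
      fix true  = 2k∸k k
      fix false = refl

    symmetric : ∀ {i} → i ≤ double k → π (double k ∸ i) ≡ double k ∸ π i
    symmetric {i} i≤ with <-cmp i k
    ... | tri< i<k _ _  = trans (central-> k s p (2k∸-> k i<k)) (cong (λ x → double k ∸ π x) (m∸[m∸n]≡n i≤))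
    ... | tri≈ _ refl _ = trans (cong π (2k∸k k)) (trans centre (sym (trans (cong (double k ∸_) centre) (2k∸k k))))
    ... | tri> _ _ k<i  = sym (trans (cong (double k ∸_) (central-> k s p k<i)) (m∸[m∸n]≡n (low-bounded (2k∸-≤ k (<⇒≤ k<i)))))

    low-injective : ∀ {i j} → i ≤ k → j ≤ k → π i ≡ π j → i ≡ j
    low-injective {i} {j} i≤k j≤k eq = P.injective (reflectIf-cancel k (s i) (s j) (p≤k i≤k) (p≤k j≤k)
      (trans (sym (central-≤ k s p i≤k)) (trans eq (central-≤ k s p j≤k))))

    -- i and 2k - j have the same image up to reflection, hence coincide; their common image is then its own reflection.
    mixed-injective : ∀ {i j} → i ≤ k → k ≤ j → j ≤ double k → π i ≡ π j → i ≡ j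
    mixed-injective {i} {j} i≤k k≤j j≤ eq = trans i≡k (≤-antisym k≤j (≮⇒≥ λ k<j → <⇒≢ (2k∸-< k k<j j≤) (trans (sym i≡j′) i≡k)))
      where
      j′≤k : double k ∸ j ≤ k
      j′≤k = 2k∸-≤ k k≤j
      πi≡ : π i ≡ double k ∸ π (double k ∸ j)
      πi≡ = trans eq (trans (sym (m∸[m∸n]≡n (bounded j≤))) (cong (double k ∸_) (sym (symmetric j≤))))
      i≡j′ : i ≡ double k ∸ j
      i≡j′ = P.injective (reflectIf-cancel k (s i) (not (s (double k ∸ j))) (p≤k i≤k) (p≤k j′≤k)
        (trans (sym (central-≤ k s p i≤k)) (trans πi≡ (trans (cong (double k ∸_) (central-≤ k s p j′≤k))
          (reflectIf-not (s (double k ∸ j)) (≤-trans (p≤k j′≤k) (k≤2k k)))))))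
      i≡k : i ≡ k
      i≡k = low-injective i≤k ≤-refl (trans (double-injective (begin
        double (π i)                ≡⟨ double≡n+n (π i) ⟩
        π i + π i                   ≡⟨ cong (_+ π i) (trans πi≡ (cong (λ x → double k ∸ π x) (sym i≡j′))) ⟩
        (double k ∸ π i) + π i      ≡⟨ m∸n+n≡m (low-bounded i≤k) ⟩
        double k                    ∎)) (sym centre))
        where open ≡-Reasoning

    injective : ∀ {i j} → i ≤ double k → j ≤ double k → π i ≡ π j → i ≡ j
    injective {i} {j} i≤ j≤ eq with ≤-total i k | ≤-total j k
    ... | inj₁ i≤k | inj₁ j≤k = low-injective i≤k j≤k eq
    ... | inj₁ i≤k | inj₂ k≤j = mixed-injective i≤k k≤j j≤ eq
    ... | inj₂ k≤i | inj₁ j≤k = sym (mixed-injective j≤k k≤i i≤ (sym eq))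
    ... | inj₂ k≤i | inj₂ k≤j = ∸-cancelˡ-≡ i≤ j≤ (low-injective (2k∸-≤ k k≤i) (2k∸-≤ k k≤j)
          (trans (symmetric i≤) (trans (cong (double k ∸_) eq) (sym (symmetric j≤)))))

  central-isCentral : s 0 ≡ false → 0 < k → IsCentral k π
  central-isCentral s0 0<k = record
    { bounded = bounded
    ; symmetric = symmetric
    ; injective = injective
    ; normalised = subst (_< k) (sym (trans (central-≤ k s p z≤n) (cong (λ b → reflectIf (double k) b (p 0)) s0))) (P.bounded 0<k)
    }

  -- Reflection in the even number `double k` preserves parity, so neither the signs nor the passage
  -- to the upper half can change it.
  odd-central : (∀ i → odd (p i) ≡ odd i) → ∀ {i} → i ≤ double k → odd (π i) ≡ odd i
  odd-central op = odd-π
    where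
    open ≡-Reasoning
    low : ∀ {i} → i ≤ k → odd (π i) ≡ odd i
    low {i} i≤k = trans (cong odd (central-≤ k s p i≤k))
      (trans (odd-reflectIf (s i) (odd-double k) (≤-trans (p≤k i≤k) (k≤2k k))) (op i))
    odd-π : ∀ {i} → i ≤ double k → odd (π i) ≡ odd i
    odd-π {i} i≤ with ≤-total i k
    ... | inj₁ i≤k = low i≤k
    ... | inj₂ k≤i = begin
      odd (π i)              ≡⟨ odd-∸ (odd-double k) (bounded i≤) ⟨
      odd (double k ∸ π i)   ≡⟨ cong odd (symmetric i≤) ⟨
      odd (π (double k ∸ i)) ≡⟨ low (2k∸-≤ k k≤i) ⟩
      odd (double k ∸ i)     ≡⟨ odd-∸ (odd-double k) i≤ ⟩
      odd i                  ∎

central-faithful : ∀ {k s s′ p p′} → IsPerm k p → IsPerm k p′ →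
  (∀ {i} → i ≤ double k → central k s p i ≡ central k s′ p′ i) →
  (∀ i → i < k → s i ≡ s′ i) × (∀ i → i < k → p i ≡ p′ i)
central-faithful {k} {s} {s′} {p} {p′} P P′ eq =
  (λ i i<k → reflectIf-cancel-sign k (s i) (s′ i) (P.bounded i<k) (P′.bounded i<k) (eq′ i i<k)) ,
  (λ i i<k → reflectIf-cancel k (s i) (s′ i) (<⇒≤ (P.bounded i<k)) (<⇒≤ (P′.bounded i<k)) (eq′ i i<k))
  where
  module P = IsPerm P
  module P′ = IsPerm P′
  eq′ : ∀ i → i < k → reflectIf (double k) (s i) (p i) ≡ reflectIf (double k) (s′ i) (p′ i)
  eq′ i i<k = trans (sym (central-≤ k s p (<⇒≤ i<k))) (trans (eq (≤-trans (<⇒≤ i<k) (k≤2k k))) (central-≤ k s′ p′ (<⇒≤ i<k)))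

-- Pigeonhole: if `y` were missed, punching it out of the codomain would give an injection into a
-- set with one element fewer.
injective⇒surjective : ∀ {n} {f : Fin n → Fin n} → Injective _≡_ _≡_ f → ∀ y → ∃ λ x → f x ≡ y
injective⇒surjective {suc n} {f} inj y with any? (λ x → f x Fin.≟ y)
... | yes found = found
... | no  none  = contradiction
  (injective⇒≤ {f = λ x → Fin.punchOut (λ e → none (x , sym e))}
    (λ {a} {b} e → inj (punchOut-injective (λ e → none (a , sym e)) (λ e → none (b , sym e)) e)))
  1+n≰n

injective⇒surjectiveℕ : ∀ w (f : ℕ → ℕ) → (∀ {i} → i ≤ w → f i ≤ w) →
  (∀ {i j} → i ≤ w → j ≤ w → f i ≡ f j → i ≡ j) → ∀ {y} → y ≤ w → ∃ λ x → x ≤ w × f x ≡ y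
injective⇒surjectiveℕ w f bd inj {y} y≤w with injective⇒surjective g-injective (fromℕ< (s≤s y≤w))
  where
  g : Fin (suc w) → Fin (suc w)
  g i = fromℕ< (s≤s (bd (s≤s⁻¹ (toℕ<n i))))
  g-injective : Injective _≡_ _≡_ g
  g-injective {i} {j} e = toℕ-injective (inj (s≤s⁻¹ (toℕ<n i)) (s≤s⁻¹ (toℕ<n j))
    (trans (sym (toℕ-fromℕ< _)) (trans (cong toℕ e) (toℕ-fromℕ< _))))
... | x , gx≡y = toℕ x , s≤s⁻¹ (toℕ<n x) , trans (sym (toℕ-fromℕ< _)) (trans (cong toℕ gx≡y) (toℕ-fromℕ< _))

-- Labelings built from a pair of symmetric sequences

data Kind : Set where
  plain low high : Kind

-- Multiplication by (N + 1) / 2 modulo N = 2h + 1.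
half : ℕ → ℕ → ℕ
half h x = [ id , suc h +_ ] (halve x)

half-even : ∀ h q → half h (double q) ≡ q
half-even h q = cong [ id , suc h +_ ] (halve-double q)

half-odd : ∀ h q → half h (suc (double q)) ≡ suc h + q
half-odd h q = cong [ id , suc h +_ ] (halve-suc-double q)

half-≤ : ∀ {h x} → x ≤ double h → half h x ≤ double h
half-≤ {h} {x} x≤ with halved x
... | 2× q   = subst (_≤ double h) (sym (half-even h q)) (≤-trans (k≤2k q) x≤)
... | 2×+1 q = subst (_≤ double h) (sym (half-odd h q)) (subst (suc h + q ≤_) (sym (double≡n+n h))
    (subst (_≤ h + h) (+-suc h q) (+-monoʳ-≤ h q<h)))
  where
  q<h : q < h
  q<h = ≰⇒> λ h≤q → <⇒≱ x≤ (double-mono-≤ h≤q)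

-- Even arguments land in 0, ..., h and odd ones above `h`, so the image reveals the parity.
half-injective : ∀ {h x y} → x ≤ double h → y ≤ double h → half h x ≡ half h y → x ≡ y
half-injective {h} {x} {y} x≤ y≤ eq with halved x | halved y
... | 2× q   | 2× r   = cong double (trans (sym (half-even h q)) (trans eq (half-even h r)))
... | 2×+1 q | 2×+1 r = cong (suc ∘ double) (+-cancelˡ-≡ (suc h) q r (trans (sym (half-odd h q)) (trans eq (half-odd h r))))
... | 2× q   | 2×+1 r = contradiction (trans (sym (half-even h q)) (trans eq (half-odd h r)))
                          (<⇒≢ (≤-trans (s≤s (double-cancel-≤ x≤)) (m≤m+n (suc h) r)))
... | 2×+1 q | 2× r   = contradiction (trans (sym (half-even h r)) (trans (sym eq) (half-odd h q)))
                          (<⇒≢ (≤-trans (s≤s (double-cancel-≤ y≤)) (m≤m+n (suc h) q)))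

value : Kind → ℕ → ℕ → ℕ
value plain h x = x
value low   h x = half h x
value high  h x = double h ∸ half h x

value-≤ : ∀ κ {h x} → x ≤ double h → value κ h x ≤ double h
value-≤ plain         x≤ = x≤
value-≤ low           x≤ = half-≤ x≤
value-≤ high {h} {x} x≤ = m∸n≤m (double h) (half h x)

value-injective : ∀ κ {h x y} → x ≤ double h → y ≤ double h → value κ h x ≡ value κ h y → x ≡ y
value-injective plain x≤ y≤ eq = eq
value-injective low   x≤ y≤ eq = half-injective x≤ y≤ eq
value-injective high  x≤ y≤ eq = half-injective x≤ y≤ (∸-cancelˡ-≡ (half-≤ x≤) (half-≤ y≤) eq)

-- Doubling `half h x` gives back `x` if `x` is even and adds the modulus `suc (double h)` if it is
-- odd. A pair of opposite parities contains exactly one odd member.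
double-half-pair : ∀ h x y → odd y ≡ not (odd x) → double (half h x + half h y) ≡ (x + y) + suc (double h)
double-half-pair h x y oy with halved x | halved y
... | 2× q   | 2× r   rewrite odd-double q | odd-double r with () ← oy
... | 2×+1 q | 2×+1 r rewrite odd-double q | odd-double r with () ← oy
... | 2× q   | 2×+1 r rewrite half-even h q | half-odd h r | double≡n+n (q + suc (h + r)) | double≡n+n q | double≡n+n r | double≡n+n h = lemma q r h
  where
  lemma : ∀ q r h → (q + suc (h + r)) + (q + suc (h + r)) ≡ (q + q) + suc (r + r) + suc (h + h)
  lemma = solve-∀
... | 2×+1 q | 2× r   rewrite half-even h r | half-odd h q | double≡n+n (h + q + r) | double≡n+n q | double≡n+n r | double≡n+n h = lemma q r h
  where
  lemma : ∀ q r h → suc (suc ((h + q + r) + (h + q + r))) ≡ suc (q + q) + (r + r) + suc (h + h)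
  lemma = solve-∀

-- These sums refer to values counted from 0; labels start at 1, which adds 4 to each face.
faceSum : Kind → ℕ → ℕ
faceSum plain h = double h + double h
faceSum low   h = suc (double h + double h)
faceSum high  h = ((double h + double h) + (double h + double h)) ∸ suc (double h + double h)

half-face : ∀ h x₁ x₂ x₃ x₄ → odd x₂ ≡ not (odd x₁) → odd x₄ ≡ not (odd x₃) →
  x₁ + x₂ + x₃ + x₄ ≡ double h + double h →
  half h x₁ + half h x₂ + half h x₃ + half h x₄ ≡ suc (double h + double h)
half-face h x₁ x₂ x₃ x₄ o₁₂ o₃₄ sum = double-injective (begin
  double (a + b + c + d)              ≡⟨ double≡n+n (a + b + c + d) ⟩
  (a + b + c + d) + (a + b + c + d)   ≡⟨ lemma a b c d ⟩
  ((a + b) + (a + b)) + ((c + d) + (c + d)) ≡⟨ cong₂ _+_ (double≡n+n (a + b)) (double≡n+n (c + d)) ⟨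
  double (a + b) + double (c + d)     ≡⟨ cong₂ _+_ (double-half-pair h x₁ x₂ o₁₂) (double-half-pair h x₃ x₄ o₃₄) ⟩
  (x₁ + x₂ + suc e) + (x₃ + x₄ + suc e) ≡⟨ lemma₂ x₁ x₂ x₃ x₄ e ⟩
  (x₁ + x₂ + x₃ + x₄) + (suc e + suc e) ≡⟨ cong (_+ (suc e + suc e)) sum ⟩
  (e + e) + (suc e + suc e)           ≡⟨ lemma₃ e ⟩
  suc (e + e) + suc (e + e)           ≡⟨ double≡n+n (suc (e + e)) ⟨
  double (suc (e + e))                ∎)
  where
  open ≡-Reasoning
  a = half h x₁
  b = half h x₂
  c = half h x₃
  d = half h x₄
  e = double h
  lemma : ∀ a b c d → (a + b + c + d) + (a + b + c + d) ≡ ((a + b) + (a + b)) + ((c + d) + (c + d))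
  lemma = solve-∀
  lemma₂ : ∀ a b c d e → (a + b + suc e) + (c + d + suc e) ≡ (a + b + c + d) + (suc e + suc e)
  lemma₂ = solve-∀
  lemma₃ : ∀ e → (e + e) + (suc e + suc e) ≡ suc (e + e) + suc (e + e)
  lemma₃ = solve-∀

value-face : ∀ κ h {x₁ x₂ x₃ x₄} → x₁ ≤ double h → x₂ ≤ double h → x₃ ≤ double h → x₄ ≤ double h →
  (κ ≢ plain → odd x₂ ≡ not (odd x₁) × odd x₄ ≡ not (odd x₃)) →
  x₁ + x₂ + x₃ + x₄ ≡ double h + double h →
  value κ h x₁ + value κ h x₂ + value κ h x₃ + value κ h x₄ ≡ faceSum κ h
value-face plain h _ _ _ _ _ sum = sum
value-face low   h {x₁} {x₂} {x₃} {x₄} _ _ _ _ o sum = half-face h x₁ x₂ x₃ x₄ (proj₁ (o λ ())) (proj₂ (o λ ())) sum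
value-face high  h {x₁} {x₂} {x₃} {x₄} b₁ b₂ b₃ b₄ o sum = begin
  c₁ + c₂ + c₃ + c₄                            ≡⟨ m+n∸n≡m (c₁ + c₂ + c₃ + c₄) σ ⟨
  (c₁ + c₂ + c₃ + c₄) + σ ∸ σ                  ≡⟨ cong (_∸ σ) (lemma c₁ c₂ c₃ c₄ (half h x₁) (half h x₂) (half h x₃) (half h x₄)) ⟩
  ((c₁ + half h x₁) + (c₂ + half h x₂)) + ((c₃ + half h x₃) + (c₄ + half h x₄)) ∸ σ
    ≡⟨ cong (_∸ σ) (cong₂ _+_ (cong₂ _+_ (m∸n+n≡m (half-≤ b₁)) (m∸n+n≡m (half-≤ b₂))) (cong₂ _+_ (m∸n+n≡m (half-≤ b₃)) (m∸n+n≡m (half-≤ b₄)))) ⟩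
  (e + e) + (e + e) ∸ σ                        ≡⟨ cong ((e + e) + (e + e) ∸_) (half-face h x₁ x₂ x₃ x₄ (proj₁ (o λ ())) (proj₂ (o λ ())) sum) ⟩
  (e + e) + (e + e) ∸ suc (e + e)              ∎
  where
  open ≡-Reasoning
  e = double h
  c₁ = e ∸ half h x₁
  c₂ = e ∸ half h x₂
  c₃ = e ∸ half h x₃
  c₄ = e ∸ half h x₄
  σ = half h x₁ + half h x₂ + half h x₃ + half h x₄
  lemma : ∀ c₁ c₂ c₃ c₄ y₁ y₂ y₃ y₄ → (c₁ + c₂ + c₃ + c₄) + (y₁ + y₂ + y₃ + y₄)
    ≡ ((c₁ + y₁) + (c₂ + y₂)) + ((c₃ + y₃) + (c₄ + y₄))
  lemma = solve-∀

-- Antipodal values before halving add up to 2h. If both are even, as at opposite corners for the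
-- halved kinds, halving gives h, and complementing each in 2h turns this into 4h - h. For positive
-- h the three sums differ.
antipodalSum : Kind → ℕ → ℕ
antipodalSum plain h = h + h
antipodalSum low   h = h
antipodalSum high  h = (h + h) + h

half-antipodal : ∀ h x x′ → odd x ≡ false → odd x′ ≡ false → x + x′ ≡ double h → half h x + half h x′ ≡ h
half-antipodal h x x′ ex ex′ sum with halved x | halved x′
... | 2×+1 q | _ rewrite odd-double q with () ← ex
... | 2× q | 2×+1 q′ rewrite odd-double q′ with () ← ex′
... | 2× q | 2× q′ rewrite half-even h q | half-even h q′ = double-injective (begin
  double (q + q′)     ≡⟨ double≡n*2 (q + q′) ⟩
  (q + q′) * 2        ≡⟨ *-distribʳ-+ 2 q q′ ⟩
  q * 2 + q′ * 2      ≡⟨ cong₂ _+_ (double≡n*2 q) (double≡n*2 q′) ⟨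
  double q + double q′ ≡⟨ sum ⟩
  double h            ∎)
  where open ≡-Reasoning

value-antipodal : ∀ κ h {x x′} → x ≤ double h → x′ ≤ double h →
  (κ ≢ plain → odd x ≡ false × odd x′ ≡ false) → x + x′ ≡ double h →
  value κ h x + value κ h x′ ≡ antipodalSum κ h
value-antipodal plain h _ _ _ sum = trans sum (double≡n+n h)
value-antipodal low   h {x} {x′} _ _ o sum = half-antipodal h x x′ (proj₁ (o λ ())) (proj₂ (o λ ())) sum
value-antipodal high  h {x} {x′} b b′ o sum = +-cancelʳ-≡ h _ _ (begin
  c + c′ + h                             ≡⟨ cong (c + c′ +_) (half-antipodal h x x′ (proj₁ (o λ ())) (proj₂ (o λ ())) sum) ⟨
  c + c′ + (half h x + half h x′)        ≡⟨ lemma c c′ (half h x) (half h x′) ⟩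
  (c + half h x) + (c′ + half h x′)      ≡⟨ cong₂ _+_ (m∸n+n≡m (half-≤ b)) (m∸n+n≡m (half-≤ b′)) ⟩
  double h + double h                    ≡⟨ cong₂ _+_ (double≡n+n h) (double≡n+n h) ⟩
  (h + h) + (h + h)                      ≡⟨ +-assoc (h + h) h h ⟨
  (h + h) + h + h                        ∎)
  where
  open ≡-Reasoning
  c = double h ∸ half h x
  c′ = double h ∸ half h x′
  lemma : ∀ a b c d → a + b + (c + d) ≡ (a + c) + (b + d)
  lemma = solve-∀

antipodalSum-injective : ∀ κ κ′ {h} → 0 < h → antipodalSum κ h ≡ antipodalSum κ′ h → κ ≡ κ′
antipodalSum-injective plain plain _ _ = refl
antipodalSum-injective low   low   _ _ = refl
antipodalSum-injective high  high  _ _ = refl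
antipodalSum-injective plain low   {h} h>0 eq = contradiction (sym eq) (<⇒≢ (m<m+n h h>0))
antipodalSum-injective low   plain {h} h>0 eq = contradiction eq (<⇒≢ (m<m+n h h>0))
antipodalSum-injective plain high  {h} h>0 eq = contradiction eq (<⇒≢ (m<m+n (h + h) h>0))
antipodalSum-injective high  plain {h} h>0 eq = contradiction (sym eq) (<⇒≢ (m<m+n (h + h) h>0))
antipodalSum-injective low   high  {h} h>0 eq = contradiction eq (<⇒≢ (<-trans (m<m+n h h>0) (m<m+n (h + h) h>0)))
antipodalSum-injective high  low   {h} h>0 eq = contradiction (sym eq) (<⇒≢ (<-trans (m<m+n h h>0) (m<m+n (h + h) h>0)))

module _ {w v : ℕ} (F : ℕ → ℕ → ℕ) (F< : ∀ {i j} → i ≤ w → j ≤ v → F i j < suc w * suc v) where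
  private
    ≤w : (i : Fin (suc w)) → toℕ i ≤ w
    ≤w i = s≤s⁻¹ (toℕ<n i)
    ≤v : (j : Fin (suc v)) → toℕ j ≤ v
    ≤v j = s≤s⁻¹ (toℕ<n j)

  fromFunction : Labeling (suc w) (suc v)
  fromFunction i j = fromℕ< (F< (≤w i) (≤v j))

  toℕ-fromFunction : ∀ i j → toℕ (fromFunction i j) ≡ F (toℕ i) (toℕ j)
  toℕ-fromFunction i j = toℕ-fromℕ< (F< (≤w i) (≤v j))

  lab-fromFunction : ∀ {i j} → i ≤ w → j ≤ v → lab fromFunction i j ≡ suc (F i j)
  lab-fromFunction {i} {j} i≤w j≤v with i <? suc w | j <? suc v
  ... | yes p | yes q = cong suc (trans (toℕ-fromFunction (fromℕ< p) (fromℕ< q)) (cong₂ F (toℕ-fromℕ< p) (toℕ-fromℕ< q)))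
  ... | yes _ | no ¬q = contradiction (s≤s j≤v) ¬q
  ... | no ¬p | _     = contradiction (s≤s i≤w) ¬p

  fromFunction-bijective : (∀ {i i′ j j′} → i ≤ w → i′ ≤ w → j ≤ v → j′ ≤ v → F i j ≡ F i′ j′ → i ≡ i′ × j ≡ j′) →
    IsBijectiveLabeling fromFunction
  fromFunction-bijective F-injective = injective , surjective
    where
    injective : Injective _≡_ _≡_ (uncurry fromFunction)
    injective {i , j} {i′ , j′} eq with F-injective (≤w i) (≤w i′) (≤v j) (≤v j′)
      (trans (sym (toℕ-fromFunction i j)) (trans (cong toℕ eq) (toℕ-fromFunction i′ j′)))
    ... | i≡ , j≡ = cong₂ _,_ (toℕ-injective i≡) (toℕ-injective j≡)
    surjective : Surjective _≡_ _≡_ (uncurry fromFunction)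
    surjective y with injective⇒surjective {f = λ c → uncurry fromFunction (remQuot {suc w} (suc v) c)}
      (λ eq → remQuot-injective {suc w} (suc v) (injective eq)) y
    ... | c , eq = remQuot {suc w} (suc v) c , λ { refl → eq }

  symEquiv⇒reflected : (F′ : ℕ → ℕ → ℕ) (L′ : Labeling (suc w) (suc v)) →
    (∀ i j → toℕ (L′ i j) ≡ F′ (toℕ i) (toℕ j)) → SymEquiv fromFunction L′ →
    ∃ λ a → ∃ λ b → ∀ {i j} → i ≤ w → j ≤ v → F′ i j ≡ F (reflectIf w a i) (reflectIf v b j)
  symEquiv⇒reflected F′ L′ toℕ-L′ (a , b , eq) = a , b , λ {i} {j} i≤w j≤v → begin
    F′ i j                                     ≡⟨ cong₂ F′ (toℕ-fromℕ< (s≤s i≤w)) (toℕ-fromℕ< (s≤s j≤v)) ⟨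
    F′ (toℕ (x i≤w)) (toℕ (y j≤v))             ≡⟨ toℕ-L′ (x i≤w) (y j≤v) ⟨
    toℕ (L′ (x i≤w) (y j≤v))                   ≡⟨ cong toℕ (eq (x i≤w) (y j≤v)) ⟩
    toℕ (fromFunction (flipIf a (x i≤w)) (flipIf b (y j≤v))) ≡⟨ toℕ-fromFunction _ _ ⟩
    F (toℕ (flipIf a (x i≤w))) (toℕ (flipIf b (y j≤v))) ≡⟨ cong₂ F (toℕ-flipIf a (x i≤w)) (toℕ-flipIf b (y j≤v)) ⟩
    F (reflectIf w a (toℕ (x i≤w))) (reflectIf v b (toℕ (y j≤v)))
      ≡⟨ cong₂ (λ i j → F (reflectIf w a i) (reflectIf v b j)) (toℕ-fromℕ< (s≤s i≤w)) (toℕ-fromℕ< (s≤s j≤v)) ⟩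
    F (reflectIf w a i) (reflectIf v b j)      ∎
    where
    open ≡-Reasoning
    x : ∀ {i} → i ≤ w → Fin (suc w)
    x i≤w = fromℕ< (s≤s i≤w)
    y : ∀ {j} → j ≤ v → Fin (suc v)
    y j≤v = fromℕ< (s≤s j≤v)
    toℕ-flipIf : ∀ {n} a (i : Fin (suc n)) → toℕ (flipIf a i) ≡ reflectIf n a (toℕ i)
    toℕ-flipIf true  i = opposite-prop i
    toℕ-flipIf false i = refl

-- Twisted sums of two symmetric sequences

twist : (w v : ℕ) (f g : ℕ → ℕ) → ℕ → ℕ → ℕ
twist w v f g i j = f (reflectIf w (odd j) i) + g (reflectIf v (odd i) j)

module Twist {w v : ℕ} (w-even : odd w ≡ false) (v-even : odd v ≡ false) where
  -- Reflections in the even numbers `w` and `v` preserve parity. The twist of the coordinates is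
  -- therefore an involution and commutes with the symmetries.
  untwist : ∀ f g a b {i j} → i ≤ w → j ≤ v →
    twist w v f g (reflectIf w a (reflectIf w (odd j) i)) (reflectIf v b (reflectIf v (odd i) j))
      ≡ f (reflectIf w a i) + g (reflectIf v b j)
  untwist f g a b {i} {j} i≤w j≤v = cong₂ (λ x y → f x + g y)
    (trans (cong (λ c → reflectIf w c (reflectIf w a (reflectIf w (odd j) i))) odd-j)
      (trans (reflectIf-comm w (odd j) a _) (cong (reflectIf w a) (reflectIf-involutive (odd j) i≤w))))
    (trans (cong (λ c → reflectIf v c (reflectIf v b (reflectIf v (odd i) j))) odd-i)
      (trans (reflectIf-comm v (odd i) b _) (cong (reflectIf v b) (reflectIf-involutive (odd i) j≤v))))
    where
    odd-j : odd (reflectIf v b (reflectIf v (odd i) j)) ≡ odd j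
    odd-j = trans (odd-reflectIf b v-even (reflectIf-≤ (odd i) j≤v)) (odd-reflectIf (odd i) v-even j≤v)
    odd-i : odd (reflectIf w a (reflectIf w (odd j) i)) ≡ odd i
    odd-i = trans (odd-reflectIf a w-even (reflectIf-≤ (odd j) i≤w)) (odd-reflectIf (odd j) w-even i≤w)

  module _ (f g : ℕ → ℕ) {A B h : ℕ} (f-sym : ∀ {i} → i ≤ w → f i + f (w ∸ i) ≡ A)
           (g-sym : ∀ {j} → j ≤ v → g j + g (v ∸ j) ≡ B) (A+B : A + B ≡ double h) where
    private
      F = twist w v f g

      f-pair : ∀ e {i} → i ≤ w → f (reflectIf w e i) + f (reflectIf w (not e) i) ≡ A
      f-pair true  {i} i≤w = trans (+-comm (f (w ∸ i)) (f i)) (f-sym i≤w)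
      f-pair false     i≤w = f-sym i≤w

      g-pair : ∀ e {j} → j ≤ v → g (reflectIf v e j) + g (reflectIf v (not e) j) ≡ B
      g-pair true  {j} j≤v = trans (+-comm (g (v ∸ j)) (g j)) (g-sym j≤v)
      g-pair false     j≤v = g-sym j≤v

      -- With vertices in the order of `FaceSums`, squares and faces across the right edge pair the
      -- f-terms as 1, 3 and 2, 4 and the g-terms as 1, 2 and 3, 4. Across the bottom edge the two
      -- pairings are exchanged, which `add-pairs′` handles by swapping the middle vertices.
      add-pairs : ∀ {f₁ f₂ f₃ f₄ g₁ g₂ g₃ g₄} → f₁ + f₃ ≡ A → f₂ + f₄ ≡ A → g₁ + g₂ ≡ B → g₃ + g₄ ≡ B →
        (f₁ + g₁) + (f₂ + g₂) + (f₃ + g₃) + (f₄ + g₄) ≡ double h + double h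
      add-pairs {f₁} {f₂} {f₃} {f₄} {g₁} {g₂} {g₃} {g₄} e₁ e₂ e₃ e₄ = begin
        (f₁ + g₁) + (f₂ + g₂) + (f₃ + g₃) + (f₄ + g₄)         ≡⟨ lemma f₁ f₂ f₃ f₄ g₁ g₂ g₃ g₄ ⟩
        ((f₁ + f₃) + (g₁ + g₂)) + ((f₂ + f₄) + (g₃ + g₄))     ≡⟨ cong₂ _+_ (cong₂ _+_ e₁ e₃) (cong₂ _+_ e₂ e₄) ⟩
        (A + B) + (A + B)                                     ≡⟨ cong₂ _+_ A+B A+B ⟩
        double h + double h                                   ∎
        where
        open ≡-Reasoning
        lemma : ∀ f₁ f₂ f₃ f₄ g₁ g₂ g₃ g₄ → (f₁ + g₁) + (f₂ + g₂) + (f₃ + g₃) + (f₄ + g₄)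
          ≡ ((f₁ + f₃) + (g₁ + g₂)) + ((f₂ + f₄) + (g₃ + g₄))
        lemma = solve-∀

      add-pairs′ : ∀ {f₁ f₂ f₃ f₄ g₁ g₂ g₃ g₄} → f₁ + f₂ ≡ A → f₃ + f₄ ≡ A → g₁ + g₃ ≡ B → g₂ + g₄ ≡ B →
        (f₁ + g₁) + (f₂ + g₂) + (f₃ + g₃) + (f₄ + g₄) ≡ double h + double h
      add-pairs′ {f₁} {f₂} {f₃} {f₄} {g₁} {g₂} {g₃} {g₄} e₁ e₂ e₃ e₄ =
        trans (lemma f₁ f₂ f₃ f₄ g₁ g₂ g₃ g₄) (add-pairs {f₁} {f₃} {f₂} {f₄} {g₁} {g₃} {g₂} {g₄} e₁ e₂ e₃ e₄)
        where
        lemma : ∀ f₁ f₂ f₃ f₄ g₁ g₂ g₃ g₄ → (f₁ + g₁) + (f₂ + g₂) + (f₃ + g₃) + (f₄ + g₄)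
          ≡ (f₁ + g₁) + (f₃ + g₃) + (f₂ + g₂) + (f₄ + g₄)
        lemma = solve-∀

    twist-≤ : ∀ {i j} → i ≤ w → j ≤ v → F i j ≤ double h
    twist-≤ {i} {j} i≤w j≤v = subst (F i j ≤_) A+B (+-mono-≤
      (subst (f (reflectIf w (odd j) i) ≤_) (f-pair (odd j) i≤w) (m≤m+n _ _))
      (subst (g (reflectIf v (odd i) j) ≤_) (g-pair (odd i) j≤v) (m≤m+n _ _)))

    -- Antipodal vertices have coordinates of the same parities, so they are twisted alike, and
    -- their f-terms and g-terms form reflected pairs.
    twist-antipodal : ∀ {i j} → i ≤ w → j ≤ v → F i j + F (w ∸ i) (v ∸ j) ≡ double h
    twist-antipodal {i} {j} i≤w j≤v = begin
      (f x + g y) + (f (reflectIf w (odd (v ∸ j)) (w ∸ i)) + g (reflectIf v (odd (w ∸ i)) (v ∸ j)))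
        ≡⟨ cong₂ (λ p q → (f x + g y) + (f p + g q)) (reflected w (odd j) i (odd-∸ v-even j≤v)) (reflected v (odd i) j (odd-∸ w-even i≤w)) ⟩
      (f x + g y) + (f (w ∸ x) + g (v ∸ y)) ≡⟨ lemma (f x) (g y) (f (w ∸ x)) (g (v ∸ y)) ⟩
      (f x + f (w ∸ x)) + (g y + g (v ∸ y)) ≡⟨ cong₂ _+_ (f-sym (reflectIf-≤ (odd j) i≤w)) (g-sym (reflectIf-≤ (odd i) j≤v)) ⟩
      A + B ≡⟨ A+B ⟩
      double h ∎
      where
      open ≡-Reasoning
      x = reflectIf w (odd j) i
      y = reflectIf v (odd i) j
      reflected : ∀ w c i {c′} → c′ ≡ c → reflectIf w c′ (w ∸ i) ≡ w ∸ reflectIf w c i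
      reflected w true  i refl = refl
      reflected w false i refl = refl
      lemma : ∀ a b c d → (a + b) + (c + d) ≡ (a + c) + (b + d)
      lemma = solve-∀

    odd-twist : (∀ {i} → i ≤ w → odd (f i) ≡ odd i) → (∀ {j} → j ≤ v → odd (g j) ≡ odd j) →
      ∀ {i j} → i ≤ w → j ≤ v → odd (F i j) ≡ odd i xor odd j
    odd-twist of og {i} {j} i≤w j≤v = trans (odd-+ (f (reflectIf w (odd j) i)) _) (cong₂ _xor_
      (trans (of (reflectIf-≤ (odd j) i≤w)) (odd-reflectIf (odd j) w-even i≤w))
      (trans (og (reflectIf-≤ (odd i) j≤v)) (odd-reflectIf (odd i) v-even j≤v)))

    -- The twisted coordinates keep the parities of `i` and `j`, and these parities tell which
    -- reflections to undo.
    twist-injective : (∀ {i i′ j j′} → i ≤ w → i′ ≤ w → j ≤ v → j′ ≤ v → f i + g j ≡ f i′ + g j′ → i ≡ i′ × j ≡ j′) →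
      ∀ {i i′ j j′} → i ≤ w → i′ ≤ w → j ≤ v → j′ ≤ v → F i j ≡ F i′ j′ → i ≡ i′ × j ≡ j′
    twist-injective inj {i} {i′} {j} {j′} i≤w i′≤w j≤v j′≤v eq
      with inj (reflectIf-≤ (odd j) i≤w) (reflectIf-≤ (odd j′) i′≤w) (reflectIf-≤ (odd i) j≤v) (reflectIf-≤ (odd i′) j′≤v) eq
    ... | x≡ , y≡ =
      trans (sym (reflectIf-involutive (odd j) i≤w)) (trans (cong₂ (reflectIf w) odd-j x≡) (reflectIf-involutive (odd j′) i′≤w)) ,
      trans (sym (reflectIf-involutive (odd i) j≤v)) (trans (cong₂ (reflectIf v) odd-i y≡) (reflectIf-involutive (odd i′) j′≤v))
      where
      odd-i : odd i ≡ odd i′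
      odd-i = trans (sym (odd-reflectIf (odd j) w-even i≤w)) (trans (cong odd x≡) (odd-reflectIf (odd j′) w-even i′≤w))
      odd-j : odd j ≡ odd j′
      odd-j = trans (sym (odd-reflectIf (odd i) v-even j≤v)) (trans (cong odd y≡) (odd-reflectIf (odd i′) v-even j′≤v))

    module _ (κ : Kind) (size : suc (double h) ≡ suc w * suc v)
             (f-odd : κ ≢ plain → ∀ {i} → i ≤ w → odd (f i) ≡ odd i)
             (g-odd : κ ≢ plain → ∀ {j} → j ≤ v → odd (g j) ≡ odd j) where
      private
        V : ℕ → ℕ → ℕ
        V i j = value κ h (F i j)

        V< : ∀ {i j} → i ≤ w → j ≤ v → V i j < suc w * suc v
        V< {i} {j} i≤w j≤v = subst (V i j <_) size (s≤s (value-≤ κ (twist-≤ i≤w j≤v)))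

      twistLabeling : Labeling (suc w) (suc v)
      twistLabeling = fromFunction V V<

      private
        odd-F : κ ≢ plain → ∀ {i j} → i ≤ w → j ≤ v → odd (F i j) ≡ odd i xor odd j
        odd-F κ≢ = odd-twist (f-odd κ≢) (g-odd κ≢)

        oddᵛ : κ ≢ plain → ∀ {i i′ j} → i ≤ w → i′ ≤ w → j ≤ v → odd i′ ≡ not (odd i) → odd (F i′ j) ≡ not (odd (F i j))
        oddᵛ κ≢ {i} {i′} {j} i≤w i′≤w j≤v o = trans (odd-F κ≢ i′≤w j≤v)
          (trans (cong (_xor odd j) o) (trans (sym (not-distribˡ-xor (odd i) (odd j))) (cong not (sym (odd-F κ≢ i≤w j≤v)))))

        oddʰ : κ ≢ plain → ∀ {i j j′} → i ≤ w → j ≤ v → j′ ≤ v → odd j′ ≡ not (odd j) → odd (F i j′) ≡ not (odd (F i j))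
        oddʰ κ≢ {i} {j} {j′} i≤w j≤v j′≤v o = trans (odd-F κ≢ i≤w j′≤v)
          (trans (cong (odd i xor_) o) (trans (sym (not-distribʳ-xor (odd i) (odd j))) (cong not (sym (odd-F κ≢ i≤w j≤v)))))

        odd-∸-suc : ∀ {u i} → odd u ≡ false → suc i ≤ u → odd (u ∸ suc i) ≡ not (odd (u ∸ i))
        odd-∸-suc eu i<u = trans (odd-∸ eu i<u) (cong not (sym (odd-∸ eu (<⇒≤ i<u))))

        face : ∀ {i₁ i₂ i₃ i₄ j₁ j₂ j₃ j₄} → i₁ ≤ w → i₂ ≤ w → i₃ ≤ w → i₄ ≤ w → j₁ ≤ v → j₂ ≤ v → j₃ ≤ v → j₄ ≤ v →
          (κ ≢ plain → odd (F i₂ j₂) ≡ not (odd (F i₁ j₁)) × odd (F i₄ j₄) ≡ not (odd (F i₃ j₃))) →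
          F i₁ j₁ + F i₂ j₂ + F i₃ j₃ + F i₄ j₄ ≡ double h + double h →
          lab twistLabeling i₁ j₁ + lab twistLabeling i₂ j₂ + lab twistLabeling i₃ j₃ + lab twistLabeling i₄ j₄ ≡ 4 + faceSum κ h
        face {i₁} {i₂} {i₃} {i₄} {j₁} {j₂} {j₃} {j₄} a₁ a₂ a₃ a₄ b₁ b₂ b₃ b₄ o sum = begin
          lab twistLabeling i₁ j₁ + lab twistLabeling i₂ j₂ + lab twistLabeling i₃ j₃ + lab twistLabeling i₄ j₄
            ≡⟨ cong₂ _+_ (cong₂ _+_ (cong₂ _+_ (lab-fromFunction V V< a₁ b₁) (lab-fromFunction V V< a₂ b₂)) (lab-fromFunction V V< a₃ b₃)) (lab-fromFunction V V< a₄ b₄) ⟩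
          suc (V i₁ j₁) + suc (V i₂ j₂) + suc (V i₃ j₃) + suc (V i₄ j₄) ≡⟨ lemma (V i₁ j₁) (V i₂ j₂) (V i₃ j₃) (V i₄ j₄) ⟩
          4 + (V i₁ j₁ + V i₂ j₂ + V i₃ j₃ + V i₄ j₄)
            ≡⟨ cong (4 +_) (value-face κ h (twist-≤ a₁ b₁) (twist-≤ a₂ b₂) (twist-≤ a₃ b₃) (twist-≤ a₄ b₄) o sum) ⟩
          4 + faceSum κ h ∎
          where
          open ≡-Reasoning
          lemma : ∀ a b c d → suc a + suc b + suc c + suc d ≡ 4 + (a + b + c + d)
          lemma = solve-∀

        square : ∀ i j → suc i < suc w → suc j < suc v →
          lab twistLabeling i j + lab twistLabeling (suc i) j + lab twistLabeling i (suc j) + lab twistLabeling (suc i) (suc j) ≡ 4 + faceSum κ h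
        square i j (s≤s i<w) (s≤s j<v) = face i≤w i<w i≤w i<w j≤v j≤v j<v j<v
          (λ κ≢ → oddᵛ κ≢ i≤w i<w j≤v refl , oddᵛ κ≢ i≤w i<w j<v refl)
          (add-pairs {f (reflectIf w (odd j) i)} {f (reflectIf w (odd j) (suc i))} {f (reflectIf w (not (odd j)) i)} {f (reflectIf w (not (odd j)) (suc i))}
            {g (reflectIf v (odd i) j)} {g (reflectIf v (not (odd i)) j)} {g (reflectIf v (odd i) (suc j))} {g (reflectIf v (not (odd i)) (suc j))}
            (f-pair (odd j) i≤w) (f-pair (odd j) i<w) (g-pair (odd i) j≤v) (g-pair (odd i) j<v))
          where
          i≤w = <⇒≤ i<w
          j≤v = <⇒≤ j<v

        rightEdge : ∀ i → suc i < suc w →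
          lab twistLabeling i v + lab twistLabeling (suc i) v + lab twistLabeling (w ∸ i) 0 + lab twistLabeling (w ∸ 1 ∸ i) 0 ≡ 4 + faceSum κ h
        -- The rewrite turns `w ∸ 1 ∸ i` into `w ∸ suc i`, the reflection of `suc i`.
        rightEdge i (s≤s i<w) rewrite ∸-+-assoc w 1 i = face i≤w i<w (m∸n≤m w i) (m∸n≤m w (suc i)) ≤-refl ≤-refl z≤n z≤n
          (λ κ≢ → oddᵛ κ≢ i≤w i<w ≤-refl refl , oddᵛ κ≢ (m∸n≤m w i) (m∸n≤m w (suc i)) z≤n (odd-∸-suc w-even i<w))
          (add-pairs {f₃ = f (w ∸ i)} {f₄ = f (w ∸ suc i)} {g₁ = g (reflectIf v (odd i) v)} {g₂ = g (reflectIf v (not (odd i)) v)} {g₃ = g (reflectIf v (odd (w ∸ i)) 0)} {g₄ = g (reflectIf v (odd (w ∸ suc i)) 0)}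
            -- The columns `v` and `0` are even, so the rows `i` and `w ∸ i` enter `f` unreflected
            -- and already form a reflected pair.
            (trans (cong (λ c → f (reflectIf w c i) + f (w ∸ i)) v-even) (f-sym i≤w))
            (trans (cong (λ c → f (reflectIf w c (suc i)) + f (w ∸ suc i)) v-even) (f-sym i<w))
            (g-pair (odd i) ≤-refl)
            (trans (cong (λ c → g (reflectIf v (odd (w ∸ i)) 0) + g (reflectIf v c 0)) (odd-∸-suc w-even i<w)) (g-pair (odd (w ∸ i)) z≤n)))
          where
          i≤w = <⇒≤ i<w

        bottomEdge : ∀ j → suc j < suc v →
          lab twistLabeling w j + lab twistLabeling w (suc j) + lab twistLabeling 0 (v ∸ j) + lab twistLabeling 0 (v ∸ 1 ∸ j) ≡ 4 + faceSum κ h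
        bottomEdge j (s≤s j<v) rewrite ∸-+-assoc v 1 j = face ≤-refl ≤-refl z≤n z≤n j≤v j<v (m∸n≤m v j) (m∸n≤m v (suc j))
          (λ κ≢ → oddʰ κ≢ ≤-refl j≤v j<v refl , oddʰ κ≢ z≤n (m∸n≤m v j) (m∸n≤m v (suc j)) (odd-∸-suc v-even j<v))
          (add-pairs′ {f₁ = f (reflectIf w (odd j) w)} {f₂ = f (reflectIf w (not (odd j)) w)} {f₃ = f (reflectIf w (odd (v ∸ j)) 0)} {f₄ = f (reflectIf w (odd (v ∸ suc j)) 0)} {g₃ = g (v ∸ j)} {g₄ = g (v ∸ suc j)}
            (f-pair (odd j) ≤-refl)
            (trans (cong (λ c → f (reflectIf w (odd (v ∸ j)) 0) + f (reflectIf w c 0)) (odd-∸-suc v-even j<v)) (f-pair (odd (v ∸ j)) z≤n))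
            -- Here the rows `w` and `0` are even, and the columns `j` and `v ∸ j` form the
            -- reflected pair.
            (trans (cong (λ c → g (reflectIf v c j) + g (v ∸ j)) w-even) (g-sym j≤v))
            (trans (cong (λ c → g (reflectIf v c (suc j)) + g (v ∸ suc j)) w-even) (g-sym j<v)))
          where
          j≤v = <⇒≤ j<v

      twistLabeling-isFaceMagic :
        (∀ {i i′ j j′} → i ≤ w → i′ ≤ w → j ≤ v → j′ ≤ v → f i + g j ≡ f i′ + g j′ → i ≡ i′ × j ≡ j′) →
        IsFaceMagic twistLabeling
      twistLabeling-isFaceMagic inj =
        fromFunction-bijective V V< (λ a a′ b b′ eq → twist-injective inj a a′ b b′ (value-injective κ (twist-≤ a b) (twist-≤ a′ b′) eq)) ,
        4 + faceSum κ h , square , rightEdge , bottomEdge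

      toℕ-twistLabeling : ∀ i j → toℕ (twistLabeling i j) ≡ V (toℕ i) (toℕ j)
      toℕ-twistLabeling = toℕ-fromFunction V V<

      twistLabeling-reflected : (V′ : ℕ → ℕ → ℕ) (L′ : Labeling (suc w) (suc v)) →
        (∀ i j → toℕ (L′ i j) ≡ V′ (toℕ i) (toℕ j)) → SymEquiv twistLabeling L′ →
        ∃ λ a → ∃ λ b → ∀ {i j} → i ≤ w → j ≤ v → V′ i j ≡ V (reflectIf w a i) (reflectIf v b j)
      twistLabeling-reflected = symEquiv⇒reflected V V<

      twistLabeling-antipodal : ∀ {i j} → i ≤ w → j ≤ v → odd i ≡ false → odd j ≡ false → V i j + V (w ∸ i) (v ∸ j) ≡ antipodalSum κ h
      twistLabeling-antipodal {i} {j} i≤w j≤v ei ej = value-antipodal κ h (twist-≤ i≤w j≤v) (twist-≤ (m∸n≤m w i) (m∸n≤m v j))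
        (λ κ≢ → trans (odd-F κ≢ i≤w j≤v) (cong₂ _xor_ ei ej) ,
                trans (odd-F κ≢ (m∸n≤m w i) (m∸n≤m v j)) (cong₂ _xor_ (trans (odd-∸ w-even i≤w) ei) (trans (odd-∸ v-even j≤v) ej)))
        (twist-antipodal i≤w j≤v)

-- Recovering the data of a labeling

Increasing : (ℕ → ℕ) → Set
Increasing α = ∀ {i j} → i < j → α i < α j

increasing-injective : ∀ {α} → Increasing α → ∀ {i j} → α i ≡ α j → i ≡ j
increasing-injective α-inc eq = ≤-antisym
  (≮⇒≥ λ j<i → <⇒≢ (α-inc j<i) (sym eq)) (≮⇒≥ λ i<j → <⇒≢ (α-inc i<j) eq)

increasing-mono-≤ : ∀ {α} → Increasing α → ∀ {i j} → i ≤ j → α i ≤ α j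
increasing-mono-≤ α-inc i≤j with m≤n⇒m<n∨m≡n i≤j
... | inj₁ i<j  = <⇒≤ (α-inc i<j)
... | inj₂ refl = ≤-refl

-- By induction `α′ (suc y)` exceeds `α y`; being a value of `α`, it is taken at an index beyond
-- `y`. Used in both directions, this shows that an increasing enumeration is determined by its set
-- of values.
increasing-dominates : ∀ {α α′ w} → Increasing α → Increasing α′ → (∀ {y} → y ≤ w → ∃ λ z → α′ y ≡ α z) →
  ∀ {y} → y ≤ w → α y ≤ α′ y
increasing-dominates {α} {α′} α-inc α′-inc image {zero} y≤w with image y≤w
... | z , eq = subst (α 0 ≤_) (sym eq) (increasing-mono-≤ α-inc z≤n)
increasing-dominates {α} {α′} α-inc α′-inc image {suc y} y<w with image y<w
... | z , eq = subst (α (suc y) ≤_) (sym eq) (increasing-mono-≤ α-inc (≰⇒> λ z≤y → <⇒≱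
      (≤-<-trans (increasing-dominates α-inc α′-inc image (<⇒≤ y<w)) (subst (α′ y <_) eq (α′-inc ≤-refl)))
      (increasing-mono-≤ α-inc z≤y)))

central-surjective : ∀ {k π} → IsCentral k π → ∀ {y} → y ≤ double k → ∃ λ x → x ≤ double k × π x ≡ y
central-surjective {k} {π} C = injective⇒surjectiveℕ (double k) π (IsCentral.bounded C) (IsCentral.injective C)

-- α is the increasing enumeration of the values of α ∘ π, so those values determine α;
-- normalisation then excludes the reflection.
axis-unique : ∀ {k α α′ π π′} → Increasing α → Increasing α′ → IsCentral k π → IsCentral k π′ → ∀ a →
  (∀ {i} → i ≤ double k → α′ (π′ i) ≡ α (π (reflectIf (double k) a i))) →
  (∀ {y} → y ≤ double k → α y ≡ α′ y) × (∀ {i} → i ≤ double k → π i ≡ π′ i)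
axis-unique {k} {α} {α′} {π} {π′} α-inc α′-inc C C′ a eq = α≡α′ , π≡π′ a eq″
  where
  module C = IsCentral C
  module C′ = IsCentral C′
  image : ∀ {y} → y ≤ double k → ∃ λ z → α′ y ≡ α z
  image y≤ with central-surjective C′ y≤
  ... | x , x≤ , refl = _ , eq x≤
  image′ : ∀ {y} → y ≤ double k → ∃ λ z → α y ≡ α′ z
  image′ y≤ with central-surjective C y≤
  ... | x , x≤ , refl = _ , sym (trans (eq (reflectIf-≤ a x≤)) (cong (α ∘ π) (reflectIf-involutive a x≤)))
  α≡α′ : ∀ {y} → y ≤ double k → α y ≡ α′ y
  α≡α′ y≤ = ≤-antisym (increasing-dominates α-inc α′-inc image y≤) (increasing-dominates α′-inc α-inc image′ y≤)
  eq″ : ∀ {i} → i ≤ double k → π′ i ≡ π (reflectIf (double k) a i)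
  eq″ i≤ = increasing-injective α-inc (trans (α≡α′ (C′.bounded i≤)) (eq i≤))
  π≡π′ : ∀ a → (∀ {i} → i ≤ double k → π′ i ≡ π (reflectIf (double k) a i)) → ∀ {i} → i ≤ double k → π i ≡ π′ i
  π≡π′ false eq i≤ = sym (eq i≤)
  π≡π′ true  eq _  = contradiction (subst (_< k) (trans (eq z≤n) (C.symmetric z≤n)) C′.normalised) (<⇒≯ (2k∸-> k C.normalised))

-- Terms are natural numbers and both column sequences attain 0. A zero of `g` gives one inequality
-- between the row terms, a zero of `g′` the other.
separate : ∀ {w v} {f g f′ g′ : ℕ → ℕ} (a b : Bool) →
  (∀ {i j} → i ≤ w → j ≤ v → f′ i + g′ j ≡ f (reflectIf w a i) + g (reflectIf v b j)) →
  (∃ λ j → j ≤ v × g j ≡ 0) → (∃ λ j → j ≤ v × g′ j ≡ 0) →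
  ∀ {i} → i ≤ w → f′ i ≡ f (reflectIf w a i)
separate {w} {v} {f} {g} {f′} {g′} a b eq (j , j≤v , gj≡0) (j′ , j′≤v , g′j′≡0) {i} i≤w = ≤-antisym
  (begin
    f′ i                             ≤⟨ m≤m+n (f′ i) _ ⟩
    f′ i + g′ (reflectIf v b j)      ≡⟨ eq i≤w (reflectIf-≤ b j≤v) ⟩
    f x + g (reflectIf v b (reflectIf v b j)) ≡⟨ cong (λ y → f x + g y) (reflectIf-involutive b j≤v) ⟩
    f x + g j                        ≡⟨ cong (f x +_) gj≡0 ⟩
    f x + 0                          ≡⟨ +-identityʳ (f x) ⟩
    f x                              ∎)
  (begin
    f x                              ≤⟨ m≤m+n (f x) _ ⟩
    f x + g (reflectIf v b j′)       ≡⟨ eq i≤w j′≤v ⟨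
    f′ i + g′ j′                     ≡⟨ cong (f′ i +_) g′j′≡0 ⟩
    f′ i + 0                         ≡⟨ +-identityʳ (f′ i) ⟩
    f′ i                             ∎)
  where
  open ≤-Reasoning
  x = reflectIf w a i

-- The first factor may be 1: prepending 1 turns the factorization sequences of (n , m) into codes for (m , n).
IsCode : ℕ → ℕ → List ℕ → Set
IsCode m n []      = ⊥
IsCode m n (d ∷ s) = 0 < d × All (1 <_) s × sizeA (d ∷ s) ≡ m × sizeB (d ∷ s) ≡ n

code-positive : ∀ {m n} s → IsCode m n s → All (0 <_) s
code-positive (d ∷ s) (d>0 , s>1 , _) = d>0 ∷ All.map <⇒≤ s>1

code-sizes : ∀ {m n} s → IsCode m n s → sizeA s ≡ m × sizeB s ≡ n
code-sizes (d ∷ s) (_ , _ , A , B) = A , B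

code-unique : ∀ {m n} s t → IsCode m n s → IsCode m n t →
  (∀ i → i < m → tileA s i ≡ tileA t i) → (∀ j → j < n → tileB s j ≡ tileB t j) → s ≡ t
code-unique (d ∷ s) (e ∷ t) (d>0 , s>1 , refl , refl) (e>0 , t>1 , A , B) eqA eqB =
  tile-injective d s e t d>0 e>0 s>1 t>1 (sym A) (sym B) eqA eqB

-- All choices behind one labeling with 2k + 1 rows and 2l + 1 columns. The parity conditions bind
-- only the two halved kinds, so plain designs may use permutations that mix parities.
record Design (k l : ℕ) : Set where
  field
    κ         : Kind
    code      : List ℕ
    isCode    : IsCode (suc (double k)) (suc (double l)) code
    π ρ       : ℕ → ℕ
    π-central : IsCentral k π
    ρ-central : IsCentral l ρ
    π-odd     : κ ≢ plain → ∀ {i} → i ≤ double k → odd (π i) ≡ odd i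
    ρ-odd     : κ ≢ plain → ∀ {j} → j ≤ double l → odd (ρ j) ≡ odd j

-- Half of mn - 1 for m = 2k + 1 and n = 2l + 1; it serves as the `h` of `half` and `value`.
middle : ℕ → ℕ → ℕ
middle k l = l + k * suc (double l)

middle-size : ∀ k l → suc (double (middle k l)) ≡ suc (double k) * suc (double l)
middle-size k l rewrite double≡n+n (l + k * suc (double l)) | double≡n+n k = lemma k l (double l) (double≡n+n l)
  where
  ring : ∀ k l → suc ((l + k * suc (l + l)) + (l + k * suc (l + l))) ≡ suc (k + k) * suc (l + l)
  ring = solve-∀
  lemma : ∀ k l v → v ≡ l + l → suc ((l + k * suc v) + (l + k * suc v)) ≡ suc (k + k) * suc v
  lemma k l _ refl = ring k l

module _ {k l : ℕ} (D : Design k l) where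
  open Design D
  private
    w = double k
    v = double l
    h = middle k l
    open Twist {w} {v} (odd-double k) (odd-double l)
    sizes = code-sizes code isCode
    positive = code-positive code isCode
    module π = IsCentral π-central
    module ρ = IsCentral ρ-central

  rowValue columnValue : ℕ → ℕ
  rowValue    = tileA code ∘ π
  columnValue = tileB code ∘ ρ

  private
    row-sym : ∀ {i} → i ≤ w → rowValue i + rowValue (w ∸ i) ≡ topA code
    row-sym {i} i≤w = trans (cong (λ x → rowValue i + tileA code x) (π.symmetric i≤w))
      (tileA-reflect code positive (trans (cong suc (m+[n∸m]≡n (π.bounded i≤w))) (sym (proj₁ sizes))))

    column-sym : ∀ {j} → j ≤ v → columnValue j + columnValue (v ∸ j) ≡ topB code
    column-sym {j} j≤v = trans (cong (λ x → columnValue j + tileB code x) (ρ.symmetric j≤v))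
      (tileB-reflect code positive (trans (cong suc (m+[n∸m]≡n (ρ.bounded j≤v))) (sym (proj₂ sizes))))

    top : topA code + topB code ≡ double h
    top = suc-injective (trans (topA+topB code positive) (trans (cong₂ _*_ (proj₁ sizes) (proj₂ sizes)) (sym (middle-size k l))))

    odd-code : All (λ d → odd d ≡ true) code
    odd-code = All-odd code (trans (cong odd (proj₁ sizes)) (cong not (odd-double k))) (trans (cong odd (proj₂ sizes)) (cong not (odd-double l)))

    row-odd : κ ≢ plain → ∀ {i} → i ≤ w → odd (rowValue i) ≡ odd i
    row-odd κ≢ {i} i≤w = trans (odd-tileA code odd-code (π i)) (π-odd κ≢ i≤w)

    column-odd : κ ≢ plain → ∀ {j} → j ≤ v → odd (columnValue j) ≡ odd j
    column-odd κ≢ {j} j≤v = trans (odd-tileB code odd-code (ρ j)) (ρ-odd κ≢ j≤v)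

    sum-injective : ∀ {i i′ j j′} → i ≤ w → i′ ≤ w → j ≤ v → j′ ≤ v →
      rowValue i + columnValue j ≡ rowValue i′ + columnValue j′ → i ≡ i′ × j ≡ j′
    sum-injective i≤ i′≤ j≤ j′≤ eq with tile-sum-injective code positive (bA (π.bounded i≤)) (bA (π.bounded i′≤)) (bB (ρ.bounded j≤)) (bB (ρ.bounded j′≤)) eq
      where
      bA : ∀ {x} → x ≤ w → x < sizeA code
      bA {x} x≤ = subst (x <_) (sym (proj₁ sizes)) (s≤s x≤)
      bB : ∀ {x} → x ≤ v → x < sizeB code
      bB {x} x≤ = subst (x <_) (sym (proj₂ sizes)) (s≤s x≤)
    ... | eqA , eqB = π.injective i≤ i′≤ eqA , ρ.injective j≤ j′≤ eqB

  designTwist : ℕ → ℕ → ℕ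
  designTwist = twist w v rowValue columnValue

  designTwist-≤ : ∀ {i j} → i ≤ w → j ≤ v → designTwist i j ≤ double h
  designTwist-≤ = twist-≤ rowValue columnValue row-sym column-sym top

  labeling : Labeling (suc (double k)) (suc (double l))
  labeling = twistLabeling rowValue columnValue row-sym column-sym top κ (middle-size k l) row-odd column-odd

  labeling-isFaceMagic : IsFaceMagic labeling
  labeling-isFaceMagic = twistLabeling-isFaceMagic rowValue columnValue row-sym column-sym top κ (middle-size k l) row-odd column-odd sum-injective

  toℕ-labeling : ∀ i j → toℕ (labeling i j) ≡ value κ h (designTwist (toℕ i) (toℕ j))
  toℕ-labeling = toℕ-twistLabeling rowValue columnValue row-sym column-sym top κ (middle-size k l) row-odd column-odd

  labeling-reflected : (V′ : ℕ → ℕ → ℕ) (L′ : Labeling (suc w) (suc v)) →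
    (∀ i j → toℕ (L′ i j) ≡ V′ (toℕ i) (toℕ j)) → SymEquiv labeling L′ →
    ∃ λ a → ∃ λ b → ∀ {i j} → i ≤ w → j ≤ v → V′ i j ≡ value κ h (designTwist (reflectIf w a i) (reflectIf v b j))
  labeling-reflected = twistLabeling-reflected rowValue columnValue row-sym column-sym top κ (middle-size k l) row-odd column-odd

  labeling-antipodal : ∀ {i j} → i ≤ w → j ≤ v → odd i ≡ false → odd j ≡ false →
    value κ h (designTwist i j) + value κ h (designTwist (w ∸ i) (v ∸ j)) ≡ antipodalSum κ h
  labeling-antipodal = twistLabeling-antipodal rowValue columnValue row-sym column-sym top κ (middle-size k l) row-odd column-odd

  row-zero : ∃ λ i → i ≤ w × rowValue i ≡ 0
  row-zero with central-surjective π-central z≤n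
  ... | i , i≤ , eq = i , i≤ , trans (cong (tileA code) eq) (tileA-0 code)

  column-zero : ∃ λ j → j ≤ v × columnValue j ≡ 0
  column-zero with central-surjective ρ-central z≤n
  ... | j , j≤ , eq = j , j≤ , trans (cong (tileB code) eq) (tileB-0 code)

-- Designs contain proofs and functions on all of ℕ, so their data are compared only on the index
-- ranges that a labeling sees.
record _≋_ {k l : ℕ} (D D′ : Design k l) : Set where
  private
    module D = Design D
    module D′ = Design D′
  field
    same-kind   : D.κ ≡ D′.κ
    same-code   : D.code ≡ D′.code
    same-row    : ∀ {i} → i ≤ double k → D.π i ≡ D′.π i
    same-column : ∀ {j} → j ≤ double l → D.ρ j ≡ D′.ρ j

-- Opposite corners give the kind, so `value` can be cancelled. Undoing the twist leaves an equation
-- between sums, whose row and column parts separate and determine code and permutations.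
labeling-unique : ∀ {k l} → 0 < l → (D D′ : Design k l) → SymEquiv (labeling D) (labeling D′) → D ≋ D′
labeling-unique {k} {l} l>0 D D′ equiv
  with labeling-reflected D (λ i j → value (Design.κ D′) (middle k l) (designTwist D′ i j)) (labeling D′) (toℕ-labeling D′) equiv
... | a , b , eq = record
  { same-kind   = κ≡κ′
  ; same-code   = code-unique D.code D′.code D.isCode D′.isCode
                    (λ { i (s≤s i≤) → proj₁ rows i≤ }) (λ { j (s≤s j≤) → proj₁ columns j≤ })
  ; same-row    = proj₂ rows
  ; same-column = proj₂ columns
  }
  where
  open ≡-Reasoning
  module D = Design D
  module D′ = Design D′
  w = double k
  v = double l
  h = middle k l
  open Twist {w} {v} (odd-double k) (odd-double l)

  V V′ : ℕ → ℕ → ℕ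
  V  i j = value D.κ h (designTwist D i j)
  V′ i j = value D′.κ h (designTwist D′ i j)

  reflectIf-w : ∀ w a → reflectIf w a w ≡ w ∸ reflectIf w a 0
  reflectIf-w w true  = refl
  reflectIf-w w false = refl

  κ≡κ′ : D.κ ≡ D′.κ
  -- The symmetry carries the corners `(0 , 0)` and `(w , v)` to opposite corners, whose coordinates
  -- are again even. Positivity of `h` follows from that of `l`.
  κ≡κ′ = antipodalSum-injective D.κ D′.κ {h} (≤-trans l>0 (m≤m+n l _)) (begin
    antipodalSum D.κ h                                    ≡⟨ labeling-antipodal D (reflectIf-≤ a z≤n) (reflectIf-≤ b z≤n)
                                                               (odd-reflectIf a (odd-double k) z≤n) (odd-reflectIf b (odd-double l) z≤n) ⟨
    V x y + V (w ∸ x) (v ∸ y)                             ≡⟨ cong₂ (λ p q → V x y + V p q) (reflectIf-w w a) (reflectIf-w v b) ⟨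
    V x y + V (reflectIf w a w) (reflectIf v b v)         ≡⟨ cong₂ _+_ (eq z≤n z≤n) (eq ≤-refl ≤-refl) ⟨
    V′ 0 0 + V′ w v                                       ≡⟨ labeling-antipodal D′ z≤n z≤n refl refl ⟩
    antipodalSum D′.κ h                                   ∎)
    where
    x = reflectIf w a 0
    y = reflectIf v b 0

  twist-eq : ∀ {i j} → i ≤ w → j ≤ v → designTwist D′ i j ≡ designTwist D (reflectIf w a i) (reflectIf v b j)
  twist-eq {i} {j} i≤ j≤ = value-injective D′.κ (designTwist-≤ D′ i≤ j≤) (designTwist-≤ D (reflectIf-≤ a i≤) (reflectIf-≤ b j≤))
    (trans (eq i≤ j≤) (cong (λ κ → value κ h (designTwist D (reflectIf w a i) (reflectIf v b j))) κ≡κ′))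

  sum-eq : ∀ {i j} → i ≤ w → j ≤ v →
    rowValue D′ i + columnValue D′ j ≡ rowValue D (reflectIf w a i) + columnValue D (reflectIf v b j)
  sum-eq {i} {j} i≤ j≤ = begin
    rowValue D′ i + columnValue D′ j                                          ≡⟨ untwist (rowValue D′) (columnValue D′) false false i≤ j≤ ⟨
    designTwist D′ (reflectIf w (odd j) i) (reflectIf v (odd i) j)            ≡⟨ twist-eq (reflectIf-≤ (odd j) i≤) (reflectIf-≤ (odd i) j≤) ⟩
    designTwist D (reflectIf w a (reflectIf w (odd j) i)) (reflectIf v b (reflectIf v (odd i) j))
                                                                              ≡⟨ untwist (rowValue D) (columnValue D) a b i≤ j≤ ⟩
    rowValue D (reflectIf w a i) + columnValue D (reflectIf v b j)            ∎

  rows : (∀ {y} → y ≤ w → tileA D.code y ≡ tileA D′.code y) × (∀ {i} → i ≤ w → D.π i ≡ D′.π i)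
  rows = axis-unique {k} {tileA D.code} {tileA D′.code} {D.π} {D′.π} (tileA-mono-< D.code) (tileA-mono-< D′.code) D.π-central D′.π-central a
    (separate {w} {v} {rowValue D} {columnValue D} {rowValue D′} {columnValue D′} a b sum-eq (column-zero D) (column-zero D′))

  columns : (∀ {y} → y ≤ v → tileB D.code y ≡ tileB D′.code y) × (∀ {j} → j ≤ v → D.ρ j ≡ D′.ρ j)
  columns = axis-unique {l} {tileB D.code} {tileB D′.code} {D.ρ} {D′.ρ} (tileB-mono-< D.code) (tileB-mono-< D′.code) D.ρ-central D′.ρ-central b
    (separate {v} {w} {columnValue D} {rowValue D} {columnValue D′} {rowValue D′} b a
      (λ {j} {i} j≤ i≤ → trans (+-comm (columnValue D′ j) (rowValue D′ i))
        (trans (sum-eq i≤ j≤) (+-comm (rowValue D (reflectIf w a i)) (columnValue D (reflectIf v b j)))))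
      (row-zero D) (row-zero D′))

-- Counting

-- The two summands mirror those of the bracket in the bound: arbitrary permutations for plain
-- labelings, parity-preserving ones for the halved kinds, with the `Bool` selecting `low` or
-- `high`.
Choice : ℕ → ℕ → Set
Choice k l = (Fin (k !) × Fin (l !)) ⊎ ((Bool × Fin (parityCount k)) × Fin (parityCount l))

choiceCount : ℕ → ℕ → ℕ
choiceCount k l = k ! * l ! + 2 * parityCount k * parityCount l

choice↔ : ∀ k l → Fin (choiceCount k l) ↔ Choice k l
choice↔ k l =
  (*↔× {k !} {l !} ⊎-↔
    ((((2↔Bool ×-↔ ↔-id (Fin (parityCount k))) ↔-∘ *↔× {2} {parityCount k}) ×-↔ ↔-id (Fin (parityCount l)))
      ↔-∘ *↔× {2 * parityCount k} {parityCount l}))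
  ↔-∘ +↔⊎ {k ! * l !} {2 * parityCount k * parityCount l}

module Choices (k l : ℕ) where
  kind : Choice k l → Kind
  kind (inj₁ _)                   = plain
  kind (inj₂ ((false , _) , _))   = low
  kind (inj₂ ((true  , _) , _))   = high

  rowPerm columnPerm : Choice k l → ℕ → ℕ
  rowPerm    (inj₁ (p , _))       = perm k p
  rowPerm    (inj₂ ((_ , p) , _)) = parityPerm k p
  columnPerm (inj₁ (_ , q))       = perm l q
  columnPerm (inj₂ (_ , q))       = parityPerm l q

  rowPerm-isPerm : ∀ c → IsPerm k (rowPerm c)
  rowPerm-isPerm (inj₁ (p , _))       = perm-isPerm k p
  rowPerm-isPerm (inj₂ ((_ , p) , _)) = parityPerm-isPerm k p

  columnPerm-isPerm : ∀ c → IsPerm l (columnPerm c)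
  columnPerm-isPerm (inj₁ (_ , q)) = perm-isPerm l q
  columnPerm-isPerm (inj₂ (_ , q)) = parityPerm-isPerm l q

  rowPerm-odd : ∀ c → kind c ≢ plain → ∀ i → odd (rowPerm c i) ≡ odd i
  rowPerm-odd (inj₁ _)             κ≢ = contradiction refl κ≢
  rowPerm-odd (inj₂ ((_ , p) , _)) _  = odd-parityPerm k p

  columnPerm-odd : ∀ c → kind c ≢ plain → ∀ j → odd (columnPerm c j) ≡ odd j
  columnPerm-odd (inj₁ _)       κ≢ = contradiction refl κ≢
  columnPerm-odd (inj₂ (_ , q)) _  = odd-parityPerm l q

  choice-unique : ∀ c c′ → kind c ≡ kind c′ → (∀ i → i < k → rowPerm c i ≡ rowPerm c′ i) →
    (∀ j → j < l → columnPerm c j ≡ columnPerm c′ j) → c ≡ c′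
  choice-unique (inj₁ (p , q)) (inj₁ (p′ , q′)) _ eq eq′ =
    cong inj₁ (cong₂ _,_ (perm-faithful k p p′ eq) (perm-faithful l q q′ eq′))
  choice-unique (inj₂ ((false , p) , q)) (inj₂ ((false , p′) , q′)) _ eq eq′ =
    cong inj₂ (cong₂ _,_ (cong (false ,_) (parityPerm-faithful k p p′ eq)) (parityPerm-faithful l q q′ eq′))
  choice-unique (inj₂ ((true , p) , q)) (inj₂ ((true , p′) , q′)) _ eq eq′ =
    cong inj₂ (cong₂ _,_ (cong (true ,_) (parityPerm-faithful k p p′ eq)) (parityPerm-faithful l q q′ eq′))
  choice-unique (inj₁ _) (inj₂ ((false , _) , _)) ()
  choice-unique (inj₁ _) (inj₂ ((true  , _) , _)) ()
  choice-unique (inj₂ ((false , _) , _)) (inj₁ _) ()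
  choice-unique (inj₂ ((true  , _) , _)) (inj₁ _) ()
  choice-unique (inj₂ ((false , _) , _)) (inj₂ ((true  , _) , _)) ()
  choice-unique (inj₂ ((true  , _) , _)) (inj₂ ((false , _) , _)) ()

module Count (k l T : ℕ) (code : Fin T → List ℕ)
             (isCode : ∀ z → IsCode (suc (double (suc k))) (suc (double (suc l))) (code z))
             (code-injective : Injective _≡_ _≡_ code) where
  open Choices (suc k) (suc l)

  Config : Set
  Config = (Fin T × (Fin (2 ^ k) × Fin (2 ^ l))) × Choice (suc k) (suc l)

  total : ℕ
  total = T * (2 ^ k * 2 ^ l) * choiceCount (suc k) (suc l)

  config↔ : Fin total ↔ Config
  config↔ =
    (((↔-id (Fin T) ×-↔ *↔× {2 ^ k} {2 ^ l}) ↔-∘ *↔× {T} {2 ^ k * 2 ^ l}) ×-↔ choice↔ (suc k) (suc l))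
    ↔-∘ *↔× {T * (2 ^ k * 2 ^ l)} {choiceCount (suc k) (suc l)}

  design : Config → Design (suc k) (suc l)
  design ((z , a , b) , c) = record
    { κ = kind c
    ; code = code z
    ; isCode = isCode z
    ; π = central (suc k) (signs k a) (rowPerm c)
    ; ρ = central (suc l) (signs l b) (columnPerm c)
    ; π-central = central-isCentral (rowPerm-isPerm c) refl z<s
    ; ρ-central = central-isCentral (columnPerm-isPerm c) refl z<s
    ; π-odd = λ κ≢ → odd-central (rowPerm-isPerm c) (rowPerm-odd c κ≢)
    ; ρ-odd = λ κ≢ → odd-central (columnPerm-isPerm c) (columnPerm-odd c κ≢)
    }

  design-unique : ∀ x y → design x ≋ design y → x ≡ y
  design-unique ((z , a , b) , c) ((z′ , a′ , b′) , c′) same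
    with central-faithful (rowPerm-isPerm c) (rowPerm-isPerm c′) (_≋_.same-row same)
       | central-faithful (columnPerm-isPerm c) (columnPerm-isPerm c′) (_≋_.same-column same)
  ... | sA , pA | sB , pB = cong₂ _,_
    (cong₂ _,_ (code-injective (_≋_.same-code same))
      -- The sign at 0 is constant, so the bits are recovered from the signs at 1 onwards.
      (cong₂ _,_ (bits-faithful k a a′ λ i i<k → sA (suc i) (s≤s i<k)) (bits-faithful l b b′ λ j j<l → sB (suc j) (s≤s j<l))))
    (choice-unique c c′ (_≋_.same-kind same) pA pB)

  labelings : List (Labeling (suc (double (suc k))) (suc (double (suc l))))
  labelings = tabulate (labeling ∘ design ∘ Inverse.to config↔)

  labelings-magic : All IsFaceMagic labelings
  labelings-magic = All.tabulate⁺ (labeling-isFaceMagic ∘ design ∘ Inverse.to config↔)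

  labelings-distinct : AllPairs (λ L L′ → ¬ SymEquiv L L′) labelings
  labelings-distinct = AllPairs.tabulate⁺ λ i≢j equiv → i≢j
    (Injection.injective (Inverse⇒Injection config↔) (design-unique _ _ (labeling-unique z<s _ _ equiv)))

  length-labelings : length labelings ≡ total
  length-labelings = length-tabulate _

-- Enumerating the factorization sequences

lookup-injective : ∀ {a} {A : Set a} {xs : List A} → Unique xs → ∀ {i j} → lookup xs i ≡ lookup xs j → i ≡ j
lookup-injective (x∉ ∷ u) {Fin.zero}  {Fin.zero}  eq = refl
lookup-injective (x∉ ∷ u) {Fin.zero}  {Fin.suc j} eq = contradiction eq (All.lookup x∉ (∈-lookup j))
lookup-injective (x∉ ∷ u) {Fin.suc i} {Fin.zero}  eq = contradiction (sym eq) (All.lookup x∉ (∈-lookup i))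
lookup-injective (x∉ ∷ u) {Fin.suc i} {Fin.suc j} eq = cong Fin.suc (lookup-injective u eq)

flat-sizes : ∀ ps → sizeA (flat ps) ≡ product (map proj₁ ps) × sizeB (flat ps) ≡ product (map proj₂ ps)
flat-sizes []             = refl , refl
flat-sizes ((a , b) ∷ ps) with flat-sizes ps
... | A , B = cong (a *_) A , cong (b *_) B

flat∷ʳ-sizes : ∀ ps e → sizeA (flat ps ++ e ∷ []) ≡ product (map proj₁ ps) * e × sizeB (flat ps ++ e ∷ []) ≡ product (map proj₂ ps)
flat∷ʳ-sizes []             e = *-comm e 1 , refl
flat∷ʳ-sizes ((a , b) ∷ ps) e with flat∷ʳ-sizes ps e
... | A , B = trans (cong (a *_) A) (sym (*-assoc a _ e)) , cong (b *_) B

flat>1 : ∀ {ps} → All (λ p → 1 < proj₁ p × 1 < proj₂ p) ps → All (1 <_) (flat ps)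
flat>1 []             = []
flat>1 ((a , b) ∷ ps) = a ∷ b ∷ flat>1 ps

projFactSeq : ∀ {m n s} → IsProjFactSeq m n s → All (1 <_) s × sizeA s ≡ m × sizeB s ≡ n
projFactSeq (inj₁ (ps , _ , ps>1 , A , B , refl)) with flat-sizes ps
... | A′ , B′ = flat>1 ps>1 , trans A′ A , trans B′ B
projFactSeq (inj₂ (ps , e , _ , ps>1 , e>1 , A , B , refl)) with flat∷ʳ-sizes ps e
... | A′ , B′ = All.++⁺ (flat>1 ps>1) (e>1 ∷ []) , trans A′ A , trans B′ B

projFactSeq⇒code : ∀ {m n} s → 1 < m → IsProjFactSeq m n s → IsCode m n s
projFactSeq⇒code s m>1 P with projFactSeq P
projFactSeq⇒code []      m>1 P | _ , refl , _         = contradiction m>1 (<-irrefl refl)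
projFactSeq⇒code (d ∷ s) m>1 P | d>1 ∷ s>1 , A , B = <⇒≤ d>1 , s>1 , A , B

projFactSeq⇒code-flipped : ∀ {m n} s → IsProjFactSeq n m s → IsCode m n (1 ∷ s)
projFactSeq⇒code-flipped s P with projFactSeq P
... | s>1 , A , B = z<s , s>1 , trans (*-identityˡ (sizeB s)) B , A

module Codes {m n : ℕ} (m>1 : 1 < m) {xs ys : List (List ℕ)} (xs! : Unique xs) (ys! : Unique ys)
             (xs-seq : ∀ {s} → s ∈ xs → IsProjFactSeq m n s) (ys-seq : ∀ {s} → s ∈ ys → IsProjFactSeq n m s) where
  private
    code⊎ : Fin (length xs) ⊎ Fin (length ys) → List ℕ
    code⊎ (inj₁ i) = lookup xs i
    code⊎ (inj₂ j) = 1 ∷ lookup ys j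

    -- Factors exceed 1, so the prepended 1 keeps the codes of the two orientations apart.
    ≢1∷ : ∀ {s t} → IsProjFactSeq m n s → s ≢ 1 ∷ t
    ≢1∷ P refl with projFactSeq P
    ... | s≤s () ∷ _ , _

    isCode⊎ : ∀ z → IsCode m n (code⊎ z)
    isCode⊎ (inj₁ i) = projFactSeq⇒code _ m>1 (xs-seq (∈-lookup i))
    isCode⊎ (inj₂ j) = projFactSeq⇒code-flipped _ (ys-seq (∈-lookup j))

    code⊎-injective : ∀ z z′ → code⊎ z ≡ code⊎ z′ → z ≡ z′
    code⊎-injective (inj₁ i) (inj₁ i′) eq = cong inj₁ (lookup-injective xs! eq)
    code⊎-injective (inj₁ i) (inj₂ j′) eq = contradiction eq (≢1∷ (xs-seq (∈-lookup i)))
    code⊎-injective (inj₂ j) (inj₁ i′) eq = contradiction (sym eq) (≢1∷ (xs-seq (∈-lookup i′)))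
    code⊎-injective (inj₂ j) (inj₂ j′) eq = cong inj₂ (lookup-injective ys! (∷-injectiveʳ eq))

    split : Fin (length xs + length ys) ↔ (Fin (length xs) ⊎ Fin (length ys))
    split = +↔⊎

  code : Fin (length xs + length ys) → List ℕ
  code = code⊎ ∘ Inverse.to split

  isCode : ∀ z → IsCode m n (code z)
  isCode = isCode⊎ ∘ Inverse.to split

  code-injective : Injective _≡_ _≡_ code
  code-injective eq = Injection.injective (Inverse⇒Injection split) (code⊎-injective _ _ eq)

-- The closed form of the bound

double/2 : ∀ k → double k / 2 ≡ k
double/2 k = trans (cong (_/ 2) (double≡n*2 k)) (m*n/n≡m k 2)

β-%4≡1 : ∀ m → m % 4 ≡ 1 → β m ≡ ((m ∸ 1) / 4) ! * ((m ∸ 1) / 4) !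
β-%4≡1 m eq with m % 4 | eq
... | .1 | refl = refl

β-%4≡3 : ∀ m → m % 4 ≡ 3 → β m ≡ ((m ∸ 3) / 4) ! * ((m + 1) / 4) !
β-%4≡3 m eq with m % 4 | eq
... | .3 | refl = refl

⌊double/2⌋ : ∀ q → ⌊ double q /2⌋ ≡ q
⌊double/2⌋ zero    = refl
⌊double/2⌋ (suc q) = cong suc (⌊double/2⌋ q)

⌊suc-double/2⌋ : ∀ q → ⌊ suc (double q) /2⌋ ≡ q
⌊suc-double/2⌋ zero    = refl
⌊suc-double/2⌋ (suc q) = cong suc (⌊suc-double/2⌋ q)

quadruple : ∀ q → double (double q) ≡ q * 4
quadruple zero    = refl
quadruple (suc q) = cong (4 +_) (quadruple q)

-- For m = 2k + 1, the case k = 2q gives m = 4q + 1 with q even and q odd positions; k = 2q + 1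
-- gives m = 4q + 3 with q + 1 even and q odd positions.
β≡parityCount : ∀ k → β (suc (double k)) ≡ parityCount k
β≡parityCount k with halved k
... | 2× q rewrite ⌊double/2⌋ q | ⌊suc-double/2⌋ q | quadruple q =
  trans (β-%4≡1 (1 + q * 4) ([m+kn]%n≡m%n 1 q 4)) (cong (λ x → x ! * x !) (m*n/n≡m q 4))
... | 2×+1 q rewrite ⌊double/2⌋ q | ⌊suc-double/2⌋ q | quadruple q =
  trans (β-%4≡3 (3 + q * 4) ([m+kn]%n≡m%n 3 q 4))
    (trans (cong₂ (λ x y → x ! * y !) (m*n/n≡m q 4) (trans (cong (_/ 4) (+-comm (3 + q * 4) 1)) (m*n/n≡m (suc q) 4)))
      (*-comm (q !) (suc q !)))

odd-form : ∀ m → 3 ≤ m → m % 2 ≡ 1 → ∃ λ k → m ≡ suc (double (suc k))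
odd-form m m≥3 odd-m with m / 2 | m≡m%n+[m/n]*n m 2
... | q | m≡ rewrite odd-m | sym (double≡n*2 q) with q
... | zero  = contradiction (subst (3 ≤_) m≡ m≥3) λ { (s≤s ()) }
... | suc k = k , m≡

-- Each axis has one free sign fewer than positions in its lower half, which makes (m - 1)/2 - 1 and
-- (n - 1)/2 - 1 signs in all.
exponent : ∀ k l → (suc (double (suc k)) + suc (double (suc l))) / 2 ∸ 3 ≡ k + l
exponent k l = cong (_∸ 3) (trans (cong (_/ 2) sum≡) (m*n/n≡m (3 + (k + l)) 2))
  where
  lemma : ∀ k l → suc (suc k + suc k) + suc (suc l + suc l) ≡ (3 + (k + l)) * 2
  lemma = solve-∀
  sum≡ : suc (double (suc k)) + suc (double (suc l)) ≡ (3 + (k + l)) * 2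
  sum≡ = trans (cong₂ (λ x y → suc x + suc y) (double≡n+n (suc k)) (double≡n+n (suc l))) (lemma k l)

theorem44 : (m n : ℕ) → 3 ≤ m → 3 ≤ n → m % 2 ≡ 1 → n % 2 ≡ 1 → m ≢ n →
    (t₁ t₂ : ℕ) → IsCount (IsProjFactSeq m n) t₁ → IsCount (IsProjFactSeq n m) t₂ →
    Σ (List (Labeling m n)) λ Ls →
    All IsFaceMagic Ls
    × AllPairs (λ L L' → ¬ SymEquiv L L') Ls
    × (t₁ + t₂) * 2 ^ ((m + n) / 2 ∸ 3)
    * (((m ∸ 1) / 2) ! * ((n ∸ 1) / 2) ! + 2 * β m * β n)
    ≤ length Ls
theorem44 m n m≥3 n≥3 odd-m odd-n _ _ _ (xs , xs! , xs-seq , refl) (ys , ys! , ys-seq , refl)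
  with odd-form m m≥3 odd-m | odd-form n n≥3 odd-n
-- The family constructed has exactly the size of the bound.
... | k , refl | l , refl = labelings , labelings-magic , labelings-distinct , ≤-reflexive (trans counts (sym length-labelings))
  where
  open Codes {m} {n} (<⇒≤ m≥3) xs! ys! (Equivalence.to (xs-seq _)) (Equivalence.to (ys-seq _))
  open Count k l (length xs + length ys) code isCode code-injective
  counts : (length xs + length ys) * 2 ^ ((m + n) / 2 ∸ 3) * (((m ∸ 1) / 2) ! * ((n ∸ 1) / 2) ! + 2 * β m * β n) ≡ total
  counts = cong₂ _*_
    (cong ((length xs + length ys) *_) (trans (cong (2 ^_) (exponent k l)) (^-distribˡ-+-* 2 k l)))
    (cong₂ _+_ (cong₂ (λ x y → x ! * y !) (double/2 (suc k)) (double/2 (suc l)))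
      (cong₂ (λ x y → 2 * x * y) (β≡parityCount (suc k)) (β≡parityCount (suc l))))
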